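{- Let $\mathbf B$ be a finite many-sorted relational structure with a balanced realization $(\pi_s,\mu_R)$, let $0<\vartheta<1$, and let $\mathbf X$ be a simple nonempty source instance. Let $\widehat{\mathbf X}$ be the gated instance and $e_{\widehat{\mathbf X}}^{\,\vartheta}$ its balanced occurrence lift with respect to the gated tables $\widehat\mu_R^{\,\vartheta}$. Then $$\mathrm{NCF}(e_{\widehat{\mathbf X}}^{\,\vartheta})=\vartheta+(1-\vartheta)\,\mathrm{NCF}(e_{\mathbf X}).$$ Every gated instance has supported global assignments (i.e. homomorphisms to the gated template), and in fact $\mathrm{NCF}(e_{\widehat{\mathbf X}}^{\,\vartheta})\ge\vartheta$.
   Context: Balanced realizations: $\mathbf B$ has sorts $s$ with finite domains $B_s$; a relation symbol $R$ of signature $(s_1,\dots,s_r)$ is interpreted by $R^{\mathbf B}\subseteq B_{s_1}\times\cdots\times B_{s_r}$. A balanced realization consists of full-support probability distributions $\pi_s$ on $B_s$ and, for each $R$, a probability distribution $\mu_R$ on $R^{\mathbf B}$ with support exactly $R^{\mathbf B}$ whose $j$th marginal is $\pi_{s_j}$. Instances: finitely many sorted variables and finitely many constraint occurrences $c=(R,(x_1,\dots,x_r))$ respecting sorts. $\mathbf X$ is simple if every constraint scope has pairwise distinct variables and every variable occurs in a constraint; nonempty means it has at least one constraint. Homomorphisms are sort-preserving assignments satisfying all constraints. Gated template: adjoin a new gate sort $M=\{0,1\}$ with uniform marginal. For each $R$ of signature $(s_1,\dots,s_r)$ put $\widehat R_0=\{(a,a,\mathbf b):a\in M,\ \mathbf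 b\in B_{s_1}\times\cdots\times B_{s_r}\}$, $\widehat R_1=\{(a,1-a,\mathbf b):a\in M,\ \mathbf b\in R^{\mathbf B}\}$, $\widehat R=\widehat R_0\cup\widehat R_1$, with table $\widehat\mu_R^{\,\vartheta}=\vartheta\nu_{R,0}+(1-\vartheta)\nu_{R,1}$, where $\nu_{R,0}(a,a,\mathbf b)=\frac12\prod_{j}\pi_{s_j}(b_j)$ on $\widehat R_0$ and $\nu_{R,1}(a,1-a,\mathbf b)=\frac12\mu_R(\mathbf b)$ on $\widehat R_1$ (zero elsewhere). This is again balanced. The gated instance $\widehat{\mathbf X}$ adds two shared variables $r,z$ of sort $M$ and replaces every constraint $c=(R,(x_1,\dots,x_r))$ by $\widehat R(r,z,x_1,\dots,x_r)$. Balanced occurrence lift of an instance over a balanced template with tables $(\pi_s,\mu_R)$: observables are one central observable for each variable, and for every constraint $c$ and position $j$ of its scope a fresh observable $x_j^c$, with outcomes in the domain of the sort. Contexts and tables: for each $c=(R,\mathbf x)$ the context of its fresh observables with table $\mu_R$ (zero off the relation), and for each $c,j$ the context $(x_j,x_j^c)$ with table $(a,b)\mapsto\pi_{s_j}(a)$ if $a=b$ and $0$ otherwise. $e_{\mathbf X}$ is this lift for $\mathbf X$ and $(\pi_s,\mu_R)$. For a finite empirical model $e$ with tables $e_C$, $\mathrm{NCF}(e)=\max\{\sum_g b_g:\ \sum_{g:\,g|_C=u}b_g\le e_C(u)\text{ for all contexts }C\text{ and local outcomes }u,\ b_g\ge0\}$, where $g$ ranges over all global assignments of outcomes to observables. 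-}

module Defs where

open import Algebra.Bundles using (CommutativeRing)
open import Data.Bool.Base using (if_then_else_)
open import Data.Fin.Base using (Fin; zero; suc; opposite)
open import Data.Fin.Properties using (_≟_)
open import Data.List.Base
  using (List; []; _∷_; _++_; map; foldr; filter; concat; tabulate; allFin;
         cartesianProductWith)
open import Data.List.Membership.Propositional using (_∈_)
open import Data.List.Membership.Propositional.Properties
  using (∈-++⁺ˡ; ∈-++⁺ʳ; ∈-++⁻; ∈-concat⁺′; ∈-concat⁻′; ∈-tabulate⁺; ∈-tabulate⁻)
open import Data.List.Relation.Unary.All as All using (All; []; _∷_)
import Data.List.Relation.Unary.All.Properties as Allₚ
import Data.List.Relation.Unary.AllPairs.Properties as AllPairsₚ
open import Data.List.Relation.Unary.Unique.Propositional using (Unique)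
import Data.List.Relation.Unary.Unique.Propositional.Properties as Uniqueₚ
open import Data.Nat.Base using (ℕ; zero; suc) renaming (_<_ to _<ₙ_)
open import Data.Product.Base
  using (Σ; ∃; ∃-syntax; ∃₂; _×_; _,_; proj₁; proj₂)
open import Data.Product.Properties using (≡-dec)
open import Data.Sum.Base using (inj₁; inj₂)
open import Data.Unit.Base using (⊤; tt)
import Data.Unit.Properties as ⊤ₚ
open import Function.Base using (_∘_)
open import Function.Bundles using (_⇔_)
open import Function.Definitions using (Injective)
open import Level using (Level; 0ℓ; _⊔_) renaming (suc to lsuc)
open import Relation.Binary.Core using (Rel)
open import Relation.Binary.Definitions using (DecidableEquality)
open import Relation.Binary.PropositionalEquality.Core using (_≡_; refl; sym; trans)
open import Relation.Binary.Structures using (IsDecTotalOrder)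
open import Relation.Nullary.Decidable.Core using (does)
open import Relation.Nullary.Negation.Core using (¬_)
open import Relation.Unary using (Pred; _∪_)

-- The real numbers are the intended instance.  agda-stdlib has none, so the
-- development is parametric in a field with a (decidable) total order
-- compatible with its operations; ℚ is an instance, and classically so is ℝ.
-- The value of 0# ⁻¹ is left unspecified.
record OrderedField (c ℓ₁ ℓ₂ : Level) : Set (lsuc (c ⊔ ℓ₁ ⊔ ℓ₂)) where
  infix 4 _≤_ _<_
  infix 8 _⁻¹
  field
    commutativeRing : CommutativeRing c ℓ₁
  open CommutativeRing commutativeRing public
    using (Carrier; _≈_; _+_; _*_; -_; _-_; 0#; 1#)
  field
    _⁻¹             : Carrier → Carrier
    _≤_             : Rel Carrier ℓ₂
    0≉1             : ¬ 0# ≈ 1#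
    ⁻¹-inverse      : ∀ x → ¬ x ≈ 0# → x * x ⁻¹ ≈ 1#
    isDecTotalOrder : IsDecTotalOrder _≈_ _≤_
    +-monoʳ-≤       : ∀ x {y z} → y ≤ z → x + y ≤ x + z
    *-nonNegative   : ∀ {x y} → 0# ≤ x → 0# ≤ y → 0# ≤ x * y

  _<_ : Rel Carrier (ℓ₁ ⊔ ℓ₂)
  x < y = x ≤ y × ¬ x ≈ y

  ½ : Carrier
  ½ = (1# + 1#) ⁻¹

  sumOver : ∀ {a} {A : Set a} → List A → (A → Carrier) → Carrier
  sumOver xs f = foldr _+_ 0# (map f xs)

  productOver : ∀ {a} {A : Set a} → List A → (A → Carrier) → Carrier
  productOver xs f = foldr _*_ 1# (map f xs)

  IsMaximum : ∀ {p} → Pred Carrier p → Carrier → Set (c ⊔ ℓ₂ ⊔ p)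
  IsMaximum S m = S m × (∀ x → S x → x ≤ m)

-- An inductively built product, rather than (j : Fin n) → Fin (d j), so that
-- equality of tuples is decidable without function extensionality.
Tuple : ∀ {n} → (Fin n → ℕ) → Set
Tuple {zero}  d = ⊤
Tuple {suc n} d = Fin (d zero) × Tuple (d ∘ suc)

lookup : ∀ {n} {d : Fin n → ℕ} → Tuple d → (j : Fin n) → Fin (d j)
lookup (a , t) zero    = a
lookup (a , t) (suc j) = lookup t j

fromFunction : ∀ {n} {d : Fin n → ℕ} → ((j : Fin n) → Fin (d j)) → Tuple d
fromFunction {zero}  f = tt
fromFunction {suc n} f = f zero , fromFunction (f ∘ suc)

_≟ₜ_ : ∀ {n} {d : Fin n → ℕ} → DecidableEquality (Tuple d)
_≟ₜ_ {zero}  = ⊤ₚ._≟_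
_≟ₜ_ {suc n} = ≡-dec _≟_ _≟ₜ_

allTuples : ∀ {n} (d : Fin n → ℕ) → List (Tuple d)
allTuples {zero}  d = tt ∷ []
allTuples {suc n} d = cartesianProductWith _,_ (allFin (d zero)) (allTuples (d ∘ suc))

record Listing (A : Set) : Set where
  field
    elements : List A
    complete : ∀ x → x ∈ elements
    unique   : Unique elements

module _ {A : Set} {n : ℕ} {k : Fin n → ℕ} (f : (i : Fin n) → Fin (k i) → A) where

  private
    rows : List (List A)
    rows = tabulate (λ i → tabulate (f i))

  elementsΣ : List A
  elementsΣ = concat rows

  ∈-elementsΣ⁺ : ∀ i j → f i j ∈ elementsΣ
  ∈-elementsΣ⁺ i j =
    ∈-concat⁺′ (∈-tabulate⁺ j) (∈-tabulate⁺ {f = λ i → tabulate (f i)} i)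

  ∈-elementsΣ⁻ : ∀ {x} → x ∈ elementsΣ → ∃₂ λ i j → x ≡ f i j
  ∈-elementsΣ⁻ x∈ with ∈-concat⁻′ rows x∈
  ... | _ , x∈row , row∈ with ∈-tabulate⁻ row∈
  ...   | i , refl with ∈-tabulate⁻ x∈row
  ...     | j , x≡ = i , j , x≡

  elementsΣ-unique : (∀ {i i′ j j′} → f i j ≡ f i′ j′ → i ≡ i′) →
                     (∀ i → Injective _≡_ _≡_ (f i)) → Unique elementsΣ
  elementsΣ-unique outer inner = Uniqueₚ.concat⁺
    (Allₚ.tabulate⁺ (λ i → Uniqueₚ.tabulate⁺ (inner i)))
    (AllPairsₚ.tabulate⁺ λ i≢i′ (x∈ , x∈′) →
      let j , p = ∈-tabulate⁻ x∈ ; j′ , q = ∈-tabulate⁻ x∈′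
      in i≢i′ (outer (trans (sym p) q)))

record Signature : Set where
  field
    #sorts   : ℕ
    #symbols : ℕ
    arity    : Fin #symbols → ℕ
    sort     : (R : Fin #symbols) → Fin (arity R) → Fin #sorts

  Sort Symbol : Set
  Sort   = Fin #sorts
  Symbol = Fin #symbols

record Structure (𝓢 : Signature) : Set₁ where
  open Signature 𝓢
  field
    #dom : Sort → ℕ

  Dom : Sort → Set
  Dom s = Fin (#dom s)

  Args : Symbol → Set
  Args R = Tuple (#dom ∘ sort R)

  field
    ⟦_⟧ : (R : Symbol) → Pred (Args R) 0ℓ

-- Variables are given sort by sort, so scopes respect sorts by construction.
record Instance (𝓢 : Signature) : Set where
  open Signature 𝓢
  field
    #vars        : Sort → ℕ
    #constraints : ℕ

  Var : Sort → Set
  Var s = Fin (#vars s)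

  Constraint : Set
  Constraint = Fin #constraints

  field
    symbol : Constraint → Symbol
    scope  : (c : Constraint) (j : Fin (arity (symbol c))) → Var (sort (symbol c) j)

  Position : Constraint → Set
  Position c = Fin (arity (symbol c))

  sortAt : (c : Constraint) → Position c → Sort
  sortAt c = sort (symbol c)

  sortedScope : (c : Constraint) → Position c → Σ Sort Var
  sortedScope c j = sortAt c j , scope c j

module _ {𝓢 : Signature} (𝐗 : Instance 𝓢) where
  open Signature 𝓢
  open Instance 𝐗

  record IsSimple : Set where
    field
      distinct : ∀ c → Injective _≡_ _≡_ (sortedScope c)
      occurs   : ∀ s (x : Var s) → ∃₂ λ c j → sortedScope c j ≡ (s , x)

  IsNonempty : Set
  IsNonempty = 0 <ₙ #constraints

  record Homomorphism (𝐁 : Structure 𝓢) : Set where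
    open Structure 𝐁
    field
      assign    : ∀ s → Var s → Dom s
      satisfies : ∀ c → ⟦ symbol c ⟧ (fromFunction (λ j → assign (sortAt c j) (scope c j)))

-- In a gated signature sort zero is the gate sort M, sort (suc s) is the old sort s.
module _ (𝓢 : Signature) where
  open Signature 𝓢

  gateSort : (R : Symbol) → Fin (suc (suc (arity R))) → Fin (suc #sorts)
  gateSort R zero          = zero
  gateSort R (suc zero)    = zero
  gateSort R (suc (suc j)) = suc (sort R j)

  gateSignature : Signature
  gateSignature = record
    { #sorts   = suc #sorts
    ; #symbols = #symbols
    ; arity    = λ R → suc (suc (arity R))
    ; sort     = gateSort
    }

gateSizes : ∀ {n} → (Fin n → ℕ) → Fin (suc n) → ℕ
gateSizes k zero    = 2
gateSizes k (suc s) = k s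

module _ {𝓢 : Signature} (𝐁 : Structure 𝓢) where
  open Signature 𝓢
  open Structure 𝐁

  GateArgs : Symbol → Set
  GateArgs R = Tuple (gateSizes #dom ∘ gateSort 𝓢 R)

  -- On Fin 2, opposite a is 1 - a.
  gateRelation₀ gateRelation₁ : (R : Symbol) → Pred (GateArgs R) 0ℓ
  gateRelation₀ R (a , a′ , b) = a′ ≡ a
  gateRelation₁ R (a , a′ , b) = a′ ≡ opposite a × ⟦ R ⟧ b

  gateStructure : Structure (gateSignature 𝓢)
  gateStructure = record
    { #dom = gateSizes #dom
    ; ⟦_⟧  = λ R → gateRelation₀ R ∪ gateRelation₁ R
    }

module _ {𝓢 : Signature} (𝐗 : Instance 𝓢) where
  open Signature 𝓢
  open Instance 𝐗

  -- The two variables of the gate sort are r = zero and z = suc zero.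
  gateScope : (c : Constraint) (j : Fin (suc (suc (arity (symbol c))))) →
              Fin (gateSizes #vars (gateSort 𝓢 (symbol c) j))
  gateScope c zero          = zero
  gateScope c (suc zero)    = suc zero
  gateScope c (suc (suc j)) = scope c j

  gateInstance : Instance (gateSignature 𝓢)
  gateInstance = record
    { #vars        = gateSizes #vars
    ; #constraints = #constraints
    ; symbol       = symbol
    ; scope        = gateScope
    }

module _ {𝓢 : Signature} (𝐗 : Instance 𝓢) where
  open Signature 𝓢
  open Instance 𝐗

  data Observable : Set where
    central : (s : Sort) → Var s → Observable
    fresh   : (c : Constraint) → Position c → Observable

  data Context : Set where
    occurrence : Constraint → Context
    link       : (c : Constraint) → Position c → Context

  contextSize : Context → ℕ
  contextSize (occurrence c) = arity (symbol c)
  contextSize (link c j)     = 2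

  member : (C : Context) → Fin (contextSize C) → Observable
  member (occurrence c) j          = fresh c j
  member (link c j)     zero       = central (sortAt c j) (scope c j)
  member (link c j)     (suc zero) = fresh c j

  member-injective : ∀ C → Injective _≡_ _≡_ (member C)
  member-injective (occurrence c) refl                   = refl
  member-injective (link c j) {zero}     {zero}     refl = refl
  member-injective (link c j) {zero}     {suc zero} ()
  member-injective (link c j) {suc zero} {zero}     ()
  member-injective (link c j) {suc zero} {suc zero} refl = refl

  observables : Listing Observable
  observables = record
    { elements = elementsΣ central ++ elementsΣ fresh
    ; complete = λ where
        (central s x) → ∈-++⁺ˡ (∈-elementsΣ⁺ central s x)
        (fresh c j)   → ∈-++⁺ʳ (elementsΣ central) (∈-elementsΣ⁺ fresh c j)
    ; unique   = Uniqueₚ.++⁺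
        (elementsΣ-unique central (λ { refl → refl }) (λ { s refl → refl }))
        (elementsΣ-unique fresh   (λ { refl → refl }) (λ { c refl → refl }))
        (λ (p , q) → clash (∈-elementsΣ⁻ central p) (∈-elementsΣ⁻ fresh q))
    }
    where
    clash : ∀ {x} {B : Set} → (∃₂ λ s y → x ≡ central s y) → (∃₂ λ c j → x ≡ fresh c j) → B
    clash (_ , _ , refl) (_ , _ , ())

  contexts : Listing Context
  contexts = record
    { elements = tabulate occurrence ++ elementsΣ link
    ; complete = λ where
        (occurrence c) → ∈-++⁺ˡ (∈-tabulate⁺ c)
        (link c j)     → ∈-++⁺ʳ (tabulate occurrence) (∈-elementsΣ⁺ link c j)
    ; unique   = Uniqueₚ.++⁺
        (Uniqueₚ.tabulate⁺ (λ { refl → refl }))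
        (elementsΣ-unique link (λ { refl → refl }) (λ { c refl → refl }))
        (λ (p , q) → clash (∈-tabulate⁻ p) (∈-elementsΣ⁻ link q))
    }
    where
    clash : ∀ {x} {B : Set} → (∃ λ c → x ≡ occurrence c) → (∃₂ λ c j → x ≡ link c j) → B
    clash (_ , refl) (_ , _ , ())

module _ {c ℓ₁ ℓ₂ : Level} (𝔽 : OrderedField c ℓ₁ ℓ₂) where
  open OrderedField 𝔽

  record IsDistribution {A : Set} (xs : List A) (p : A → Carrier) : Set (c ⊔ ℓ₁ ⊔ ℓ₂) where
    field
      nonNegative : ∀ x → 0# ≤ p x
      normalised  : sumOver xs p ≈ 1#

  record Tables {𝓢 : Signature} (𝐁 : Structure 𝓢) : Set c where
    open Signature 𝓢
    open Structure 𝐁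
    field
      π : (s : Sort) → Dom s → Carrier
      μ : (R : Symbol) → Args R → Carrier

  -- Each μ R is a function on all of B_{s₁} × ⋯ × B_{sᵣ}, extended by zero off
  -- the relation: a nonnegative function whose support is the relation.
  record IsBalanced {𝓢 : Signature} {𝐁 : Structure 𝓢} (𝒯 : Tables 𝐁) :
                    Set (c ⊔ ℓ₁ ⊔ ℓ₂) where
    open Signature 𝓢
    open Structure 𝐁
    open Tables 𝒯
    field
      π-distribution : ∀ s → IsDistribution (allFin (#dom s)) (π s)
      π-fullSupport  : ∀ s a → 0# < π s a
      μ-distribution : ∀ R → IsDistribution (allTuples (#dom ∘ sort R)) (μ R)
      μ-support      : ∀ R t → 0# < μ R t ⇔ ⟦ R ⟧ t
      μ-marginal     : ∀ R j a →
        sumOver (filter (λ t → lookup t j ≟ a) (allTuples (#dom ∘ sort R))) (μ R)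
          ≈ π (sort R j) a

  module _ {𝓢 : Signature} {𝐁 : Structure 𝓢} (𝒯 : Tables 𝐁) where
    open Signature 𝓢
    open Structure 𝐁
    open Tables 𝒯

    gateπ : (s : Fin (suc #sorts)) → Fin (gateSizes #dom s) → Carrier
    gateπ zero    a = ½
    gateπ (suc s) a = π s a

    -- μ R b already vanishes for b outside the relation, so ν₁ does too.
    ν₀ ν₁ : (R : Symbol) → GateArgs 𝐁 R → Carrier
    ν₀ R (a , a′ , b) =
      if does (a′ ≟ a)
      then ½ * productOver (allFin (arity R)) (λ j → π (sort R j) (lookup b j))
      else 0#
    ν₁ R (a , a′ , b) = if does (a′ ≟ opposite a) then ½ * μ R b else 0#

    gateTables : Carrier → Tables (gateStructure 𝐁)
    gateTables ϑ = record
      { π = gateπ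
      ; μ = λ R t → ϑ * ν₀ R t + (1# - ϑ) * ν₁ R t
      }

  -- Normalisation and compatibility of the tables are not recorded: the
  -- noncontextual fraction is defined by the tables alone.
  record EmpiricalModel : Set (lsuc 0ℓ ⊔ c) where
    field
      Obs             : Set
      obsListing      : Listing Obs
      #outcomes       : Obs → ℕ
      Ctx             : Set
      ctxListing      : Listing Ctx
      size            : Ctx → ℕ
      obsAt           : (C : Ctx) → Fin (size C) → Obs
      obsAt-injective : ∀ C → Injective _≡_ _≡_ (obsAt C)

    LocalOutcome : Ctx → Set
    LocalOutcome C = Tuple (#outcomes ∘ obsAt C)

    field
      table : (C : Ctx) → LocalOutcome C → Carrier

    Outcome : Obs → Set
    Outcome o = Fin (#outcomes o)

    GlobalAssignment : Set
    GlobalAssignment = All Outcome (Listing.elements obsListing)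

    restrict : GlobalAssignment → (C : Ctx) → LocalOutcome C
    restrict g C = fromFunction (λ i → All.lookup g (Listing.complete obsListing (obsAt C i)))

    assignmentsOn : (os : List Obs) → List (All Outcome os)
    assignmentsOn []       = [] ∷ []
    assignmentsOn (o ∷ os) =
      cartesianProductWith _∷_ (allFin (#outcomes o)) (assignmentsOn os)

    globalAssignments : List GlobalAssignment
    globalAssignments = assignmentsOn (Listing.elements obsListing)

  module _ (e : EmpiricalModel) where
    open EmpiricalModel e

    IsSupported : GlobalAssignment → Set (ℓ₁ ⊔ ℓ₂)
    IsSupported g = ∀ C → 0# < table C (restrict g C)

    record IsFeasible (b : GlobalAssignment → Carrier) : Set ℓ₂ where
      field
        nonNegative : ∀ g → 0# ≤ b g
        bounded     : ∀ C u →
          sumOver (filter (λ g → restrict g C ≟ₜ u) globalAssignments) b ≤ table C u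

    -- "NCF(e) exists and equals v".
    IsNCF : Carrier → Set (c ⊔ ℓ₁ ⊔ ℓ₂)
    IsNCF = IsMaximum (λ w → ∃[ b ] IsFeasible b × sumOver globalAssignments b ≈ w)

  module _ {𝓢 : Signature} {𝐁 : Structure 𝓢} (𝐗 : Instance 𝓢) (𝒯 : Tables 𝐁) where
    open Structure 𝐁
    open Instance 𝐗
    open Tables 𝒯

    liftOutcomes : Observable 𝐗 → ℕ
    liftOutcomes (central s x) = #dom s
    liftOutcomes (fresh k j)   = #dom (sortAt k j)

    liftTable : (C : Context 𝐗) → Tuple (liftOutcomes ∘ member 𝐗 C) → Carrier
    liftTable (occurrence k) u           = μ (symbol k) u
    liftTable (link k j)     (a , b , _) = if does (a ≟ b) then π (sortAt k j) a else 0#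

    occurrenceLift : EmpiricalModel
    occurrenceLift = record
      { Obs             = Observable 𝐗
      ; obsListing      = observables 𝐗
      ; #outcomes       = liftOutcomes
      ; Ctx             = Context 𝐗
      ; ctxListing      = contexts 𝐗
      ; size            = contextSize 𝐗
      ; obsAt           = member 𝐗
      ; obsAt-injective = member-injective 𝐗
      ; table           = liftTable
      }

{-# OPTIONS --safe #-}
module Submission where

-- Link contexts force every fresh observable to follow its central one, so a global
-- assignment of the gated lift amounts to values of r and z and an assignment of 𝐗, and the
-- weights split according to whether r = z or r ≠ z.  On r = z the tables are ϑ times the
-- product of the πₛ, and since scopes have distinct variables the product measure attains the
-- full mass ϑ; on r ≠ z they are (1 - ϑ) times the tables of 𝐗, giving (1 - ϑ) NCF(e_𝐗).
-- That the maximum NCF(e_𝐗) exists over an arbitrary ordered field is Fourier–Motzkin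
-- elimination applied to the defining linear program.

open import Defs
open import Algebra.Bundles using (CommutativeRing)
import Algebra.Properties.CommutativeSemigroup as CommutativeSemigroupProperties
import Algebra.Properties.Ring as RingProperties
import Algebra.Solver.Ring.NaturalCoefficients.Default as SemiringSolver
open import Data.Bool.Base using (false; if_then_else_; true)
open import Data.Fin.Base using (Fin; fromℕ<; opposite; suc; zero)
open import Data.Fin.Properties using (_≟_; suc-injective)
open import Data.List.Base
  using (List; []; _++_; _∷_; allFin; cartesianProduct; cartesianProductWith; concat; filter;
         foldr; length; map; tabulate)
open import Data.List.Membership.Propositional using (_∈_)
open import Data.List.Membership.Propositional.Properties
  using (∈-allFin; ∈-cartesianProductWith⁺; ∈-cartesianProductWith⁻)
open import Data.List.Properties using (map-tabulate)
open import Data.List.Relation.Unary.All as All using (All; []; _∷_)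
import Data.List.Relation.Unary.All.Properties as Allₚ
open import Data.List.Relation.Unary.AllPairs using ([]; _∷_)
open import Data.List.Relation.Unary.Any using (here; there)
open import Data.List.Relation.Unary.Unique.Propositional using (Unique)
import Data.List.Relation.Unary.Unique.Propositional.Properties as Uniqueₚ
open import Data.Nat.Base using (suc; zero; ℕ) renaming (_+_ to _+ₙ_)
open import Data.Product.Base using (_,_; _×_; proj₁; proj₂; Σ; ∃; ∃-syntax; ∃₂)
open import Data.Product.Properties using (,-injective)
open import Data.Sum.Base using (inj₁; inj₂)
open import Data.Unit.Base using (tt)
open import Data.Vec.Base as Vec using (Vec; []; _∷_)
open import Function.Base using (_∘_; id)
open import Function.Definitions using (Injective)
import Level
open import Relation.Binary.Bundles using (Poset)
open import Relation.Binary.Definitions using (DecidableEquality)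
open import Relation.Binary.PropositionalEquality.Core as ≡ using (_≡_; _≢_)
import Relation.Binary.Reasoning.PartialOrder as PartialOrderReasoning
open import Relation.Binary.Structures using (IsDecTotalOrder)
open import Relation.Nullary.Decidable.Core using (Dec; _×-dec_; does; map′; no; yes)
open import Relation.Nullary.Negation.Core using (contradiction; ¬_)
open import Relation.Unary using (Decidable; Pred)

-- The upper bound treats the two halves of a gated weight differently. The `r ≠ z` half satisfies
-- occurrence bounds scaled by `1# - ϑ`, because the two entries at `(a , opposite a , t)` add up to
-- `(1# - ϑ) * μ R t`. Its link bounds do not scale: a gated link of an old variable has the table
-- it has without the gate, and it does not see whether `r ≠ z`. After division by `1# - ϑ` they are
-- therefore recovered from the occurrence bounds through the marginal condition on `μ`. Of the
-- `r = z` half only the total matters, and one occurrence table, summed over its `r = z` entries,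
-- caps it at `ϑ`; a constraint of 𝐗 is needed for this. In the lower bound the factor `½` makes
-- both gate marginals uniform, and the gate links are respected because both glued weights have
-- total at most `1#`. The field need not be complete, so compactness cannot produce an optimal
-- weight. Instead the objective becomes one more variable of the linear system, and all other
-- variables are eliminated.

module OrderedFieldProperties {c ℓ₁ ℓ₂} (𝔽 : OrderedField c ℓ₁ ℓ₂) where
  open OrderedField 𝔽
  open CommutativeRing commutativeRing public
    using ( refl; sym; trans; reflexive; +-cong; +-congˡ; +-congʳ; *-cong; *-congˡ; *-congʳ
          ; +-comm; +-assoc; +-identityˡ; +-identityʳ; -‿inverseˡ; -‿inverseʳ; -‿cong
          ; *-comm; *-assoc; *-identityˡ; *-identityʳ; distribˡ; distribʳ; zeroˡ; zeroʳ
          ; +-commutativeSemigroup; ring; commutativeSemiring )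
  open RingProperties ring public
    using (-‿distribˡ-*; -‿distribʳ-*; -‿involutive; -‿+-comm; -0#≈0#)
  open CommutativeSemigroupProperties +-commutativeSemigroup using (interchange)
  open IsDecTotalOrder isDecTotalOrder public
    using (isPartialOrder)
    renaming (refl to ≤-refl; trans to ≤-trans; antisym to ≤-antisym; total to ≤-total;
              reflexive to ≤-reflexive; _≟_ to _≈?_)
  module Solver = SemiringSolver commutativeSemiring

  poset : Poset c ℓ₁ ℓ₂
  poset = record { isPartialOrder = isPartialOrder }

  open PartialOrderReasoning poset public

  -- Order arithmetic in an ordered field.

  ≤-respʳ : ∀ {x y z} → y ≈ z → x ≤ y → x ≤ z
  ≤-respʳ y≈z x≤y = ≤-trans x≤y (≤-reflexive y≈z)

  ≤-respˡ : ∀ {x y z} → x ≈ y → x ≤ z → y ≤ z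
  ≤-respˡ x≈y x≤z = ≤-trans (≤-reflexive (sym x≈y)) x≤z

  +-monoˡ-≤ : ∀ x {y z} → y ≤ z → y + x ≤ z + x
  +-monoˡ-≤ x {y} {z} y≤z = begin
    y + x ≈⟨ +-comm y x ⟩
    x + y ≤⟨ +-monoʳ-≤ x y≤z ⟩
    x + z ≈⟨ +-comm x z ⟩
    z + x ∎

  +-mono-≤ : ∀ {x y u v} → x ≤ y → u ≤ v → x + u ≤ y + v
  +-mono-≤ {y = y} {u} x≤y u≤v = ≤-trans (+-monoˡ-≤ u x≤y) (+-monoʳ-≤ y u≤v)

  +-nonNegative : ∀ {x y} → 0# ≤ x → 0# ≤ y → 0# ≤ x + y
  +-nonNegative 0≤x 0≤y = ≤-respˡ (+-identityˡ 0#) (+-mono-≤ 0≤x 0≤y)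

  x≤x+y : ∀ x {y} → 0# ≤ y → x ≤ x + y
  x≤x+y x 0≤y = ≤-respˡ (+-identityʳ x) (+-monoʳ-≤ x 0≤y)

  x-y+y≈x : ∀ x y → (x - y) + y ≈ x
  x-y+y≈x x y = begin-equality
    (x - y) + y     ≈⟨ +-assoc x (- y) y ⟩
    x + (- y + y)   ≈⟨ +-congˡ (-‿inverseˡ y) ⟩
    x + 0#          ≈⟨ +-identityʳ x ⟩
    x               ∎

  x≤y⇒0≤y-x : ∀ {x y} → x ≤ y → 0# ≤ y - x
  x≤y⇒0≤y-x {x} x≤y = ≤-respˡ (-‿inverseʳ x) (+-monoˡ-≤ (- x) x≤y)

  0≤y-x⇒x≤y : ∀ {x y} → 0# ≤ y - x → x ≤ y
  0≤y-x⇒x≤y {x} {y} 0≤y-x = begin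
    x            ≈⟨ +-identityˡ x ⟨
    0# + x       ≤⟨ +-monoˡ-≤ x 0≤y-x ⟩
    (y - x) + x  ≈⟨ x-y+y≈x y x ⟩
    y            ∎

  *-monoˡ-≤ : ∀ {k x y} → 0# ≤ k → x ≤ y → k * x ≤ k * y
  *-monoˡ-≤ {k} {x} {y} 0≤k x≤y = 0≤y-x⇒x≤y (≤-respʳ eq (*-nonNegative 0≤k (x≤y⇒0≤y-x x≤y)))
    where
    eq : k * (y - x) ≈ k * y - k * x
    eq = trans (distribˡ k y (- x)) (+-congˡ (sym (-‿distribʳ-* k x)))

  *-monoʳ-≤ : ∀ {k x y} → 0# ≤ k → x ≤ y → x * k ≤ y * k
  *-monoʳ-≤ {k} {x} {y} 0≤k x≤y = begin
    x * k  ≈⟨ *-comm x k ⟩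
    k * x  ≤⟨ *-monoˡ-≤ 0≤k x≤y ⟩
    k * y  ≈⟨ *-comm k y ⟩
    y * k  ∎

  neg-antimono-≤ : ∀ {x y} → x ≤ y → - y ≤ - x
  neg-antimono-≤ {x} {y} x≤y = 0≤y-x⇒x≤y (≤-respʳ eq (x≤y⇒0≤y-x x≤y))
    where
    eq : y - x ≈ - x - - y
    eq = trans (+-comm y (- x)) (+-congˡ (sym (-‿involutive y)))

  0≤1 : 0# ≤ 1#
  0≤1 with ≤-total 0# 1#
  ... | inj₁ 0≤1 = 0≤1
  ... | inj₂ 1≤0 = ≤-respʳ eq (*-nonNegative 0≤-1 0≤-1)
    where
    0≤-1 : 0# ≤ - 1#
    0≤-1 = ≤-respˡ -0#≈0# (neg-antimono-≤ 1≤0)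
    eq : - 1# * - 1# ≈ 1#
    eq = begin-equality
      - 1# * - 1#     ≈⟨ -‿distribˡ-* 1# (- 1#) ⟨
      - (1# * - 1#)   ≈⟨ -‿cong (*-identityˡ (- 1#)) ⟩
      - - 1#          ≈⟨ -‿involutive 1# ⟩
      1#              ∎

  <⇒≉ˡ : ∀ {x y} → x < y → ¬ y ≈ x
  <⇒≉ˡ (_ , x≉y) y≈x = x≉y (sym y≈x)

  *-inverseˡ : ∀ {x} → 0# < x → x ⁻¹ * x ≈ 1#
  *-inverseˡ {x} 0<x = trans (*-comm (x ⁻¹) x) (⁻¹-inverse x (<⇒≉ˡ 0<x))

  ⁻¹-nonNegative : ∀ {x} → 0# < x → 0# ≤ x ⁻¹
  ⁻¹-nonNegative {x} 0<x@(0≤x , _) with ≤-total 0# (x ⁻¹)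
  ... | inj₁ 0≤x⁻¹ = 0≤x⁻¹
  ... | inj₂ x⁻¹≤0 = contradiction (≤-antisym 0≤1 1≤0) 0≉1
    where
    1≤0 : 1# ≤ 0#
    1≤0 = begin
      1#        ≈⟨ ⁻¹-inverse x (<⇒≉ˡ 0<x) ⟨
      x * x ⁻¹  ≤⟨ *-monoˡ-≤ 0≤x x⁻¹≤0 ⟩
      x * 0#    ≈⟨ zeroʳ x ⟩
      0#        ∎

  *-positive : ∀ {x y} → 0# < x → 0# < y → 0# < x * y
  *-positive {x} {y} 0<x@(0≤x , _) 0<y@(0≤y , 0≉y) = *-nonNegative 0≤x 0≤y , λ 0≈xy →
    0≉y (begin-equality
      0#              ≈⟨ zeroʳ (x ⁻¹) ⟨
      x ⁻¹ * 0#       ≈⟨ *-congˡ 0≈xy ⟩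
      x ⁻¹ * (x * y)  ≈⟨ *-assoc (x ⁻¹) x y ⟨
      x ⁻¹ * x * y    ≈⟨ *-congʳ (*-inverseˡ 0<x) ⟩
      1# * y          ≈⟨ *-identityˡ y ⟩
      y               ∎)

  productOver-positive : ∀ {a} {A : Set a} (xs : List A) {f : A → Carrier} →
                         (∀ x → 0# < f x) → 0# < productOver xs f
  productOver-positive []       0<f = 0≤1 , 0≉1
  productOver-positive (x ∷ xs) 0<f = *-positive (0<f x) (productOver-positive xs 0<f)

  <-≤-trans : ∀ {x y z} → x < y → y ≤ z → x < z
  <-≤-trans (x≤y , x≉y) y≤z =
    ≤-trans x≤y y≤z , λ x≈z → x≉y (≤-antisym x≤y (≤-respʳ (sym x≈z) y≤z))

  0<1 : 0# < 1#
  0<1 = 0≤1 , 0≉1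

  0<2 : 0# < 1# + 1#
  0<2 = <-≤-trans 0<1 (x≤x+y 1# 0≤1)

  0≤½ : 0# ≤ ½
  0≤½ = ⁻¹-nonNegative 0<2

  ½+½≈1 : ½ + ½ ≈ 1#
  ½+½≈1 = begin-equality
    ½ + ½            ≈⟨ Solver.solve 1 (λ h → h Solver.:+ h
                          Solver.:= h Solver.:* (Solver.con 1 Solver.:+ Solver.con 1)) refl ½ ⟩
    ½ * (1# + 1#)    ≈⟨ *-inverseˡ 0<2 ⟩
    1#               ∎

  0<½ : 0# < ½
  0<½ = 0≤½ , λ 0≈½ → 0≉1 (trans (trans (sym (+-identityʳ 0#)) (+-cong 0≈½ 0≈½)) ½+½≈1)

  -- Indicators and finite sums.

  𝟙 : ∀ {p} {P : Set p} → Dec P → Carrier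
  𝟙 P? = if does P? then 1# else 0#

  module _ {p} {P : Set p} where

    𝟙-yes : (P? : Dec P) → P → 𝟙 P? ≈ 1#
    𝟙-yes (yes _) _ = refl
    𝟙-yes (no ¬p) p = contradiction p ¬p

    𝟙-no : (P? : Dec P) → ¬ P → 𝟙 P? ≈ 0#
    𝟙-no (yes p) ¬p = contradiction p ¬p
    𝟙-no (no _)  _  = refl

    𝟙-nonNegative : (P? : Dec P) → 0# ≤ 𝟙 P?
    𝟙-nonNegative (yes _) = 0≤1
    𝟙-nonNegative (no _)  = ≤-refl

    if-𝟙 : (P? : Dec P) (x : Carrier) → (if does P? then x else 0#) ≈ 𝟙 P? * x
    if-𝟙 (yes _) x = sym (*-identityˡ x)
    if-𝟙 (no _)  x = sym (zeroˡ x)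

  𝟙-mono : ∀ {p q} {P : Set p} {Q : Set q} (P? : Dec P) (Q? : Dec Q) → (P → Q) → 𝟙 P? ≤ 𝟙 Q?
  𝟙-mono (yes p) Q? p⇒q = ≤-reflexive (sym (𝟙-yes Q? (p⇒q p)))
  𝟙-mono (no _)  Q? _   = 𝟙-nonNegative Q?

  module _ {p q} {P : Set p} {Q : Set q} where

    𝟙-cong : (P? : Dec P) (Q? : Dec Q) → (P → Q) → (Q → P) → 𝟙 P? ≈ 𝟙 Q?
    𝟙-cong P? Q? p⇒q q⇒p = ≤-antisym (𝟙-mono P? Q? p⇒q) (𝟙-mono Q? P? q⇒p)

    𝟙-× : (P? : Dec P) (Q? : Dec Q) → 𝟙 (P? ×-dec Q?) ≈ 𝟙 P? * 𝟙 Q?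
    𝟙-× (yes _) (yes _) = sym (*-identityˡ 1#)
    𝟙-× (yes _) (no _)  = sym (*-identityˡ 0#)
    𝟙-× (no _)  (yes _) = sym (zeroˡ 1#)
    𝟙-× (no _)  (no _)  = sym (zeroˡ 0#)

  ∑ : ∀ {a} {A : Set a} → List A → (A → Carrier) → Carrier
  ∑ = sumOver

  syntax ∑ xs (λ x → e) = ∑[ x ∈ xs ] e
  infix 8 ∑

  module _ {a} {A : Set a} where

    ∑-cong : (xs : List A) {f g : A → Carrier} → (∀ x → f x ≈ g x) → ∑ xs f ≈ ∑ xs g
    ∑-cong []       f≈g = refl
    ∑-cong (x ∷ xs) f≈g = +-cong (f≈g x) (∑-cong xs f≈g)

    ∑-mono : (xs : List A) {f g : A → Carrier} → (∀ x → f x ≤ g x) → ∑ xs f ≤ ∑ xs g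
    ∑-mono []       f≤g = ≤-refl
    ∑-mono (x ∷ xs) f≤g = +-mono-≤ (f≤g x) (∑-mono xs f≤g)

    ∑-0 : (xs : List A) → ∑[ x ∈ xs ] 0# ≈ 0#
    ∑-0 []       = refl
    ∑-0 (x ∷ xs) = trans (+-identityˡ _) (∑-0 xs)

    ∑-nonNegative : (xs : List A) {f : A → Carrier} → (∀ x → 0# ≤ f x) → 0# ≤ ∑ xs f
    ∑-nonNegative xs 0≤f = ≤-respˡ (∑-0 xs) (∑-mono xs 0≤f)

    ∑-+ : (xs : List A) (f g : A → Carrier) → ∑[ x ∈ xs ] (f x + g x) ≈ ∑ xs f + ∑ xs g
    ∑-+ []       f g = sym (+-identityˡ 0#)
    ∑-+ (x ∷ xs) f g = trans (+-congˡ (∑-+ xs f g)) (interchange _ _ _ _)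

    ∑-*ˡ : (xs : List A) (k : Carrier) (f : A → Carrier) → ∑[ x ∈ xs ] (k * f x) ≈ k * ∑ xs f
    ∑-*ˡ []       k f = sym (zeroʳ k)
    ∑-*ˡ (x ∷ xs) k f = trans (+-congˡ (∑-*ˡ xs k f)) (sym (distribˡ k _ _))

    ∑-++ : (xs ys : List A) (f : A → Carrier) → ∑ (xs ++ ys) f ≈ ∑ xs f + ∑ ys f
    ∑-++ []       ys f = sym (+-identityˡ _)
    ∑-++ (x ∷ xs) ys f = trans (+-congˡ (∑-++ xs ys f)) (sym (+-assoc _ _ _))

    ∑-∈ : {xs : List A} {f : A → Carrier} {x : A} → (∀ x → 0# ≤ f x) → x ∈ xs → f x ≤ ∑ xs f
    ∑-∈ {y ∷ xs} {f} 0≤f (here ≡.refl) = x≤x+y (f y) (∑-nonNegative xs 0≤f)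
    ∑-∈ {y ∷ xs} {f} {x} 0≤f (there x∈) = begin
      f x           ≈⟨ +-identityˡ (f x) ⟨
      0# + f x      ≤⟨ +-mono-≤ (0≤f y) (∑-∈ 0≤f x∈) ⟩
      ∑ (y ∷ xs) f  ∎

    -- Feasibility is stated with filtered lists. In indicator form the condition is a factor of the
    -- summand, so sums can be exchanged and events multiplied by algebra alone.
    ∑-filter : ∀ {p} {P : Pred A p} (P? : Decidable P) (xs : List A) (f : A → Carrier) →
               ∑ (filter P? xs) f ≈ ∑[ x ∈ xs ] (𝟙 (P? x) * f x)
    ∑-filter P? []       f = refl
    ∑-filter P? (x ∷ xs) f with does (P? x)
    ... | true  = +-cong (sym (*-identityˡ (f x))) (∑-filter P? xs f)
    ... | false = trans (∑-filter P? xs f)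
                        (trans (sym (+-identityˡ _)) (+-congʳ (sym (zeroˡ (f x)))))

  ∑-map : ∀ {a b} {A : Set a} {B : Set b} (h : A → B) (xs : List A) (f : B → Carrier) →
          ∑ (map h xs) f ≈ ∑ xs (f ∘ h)
  ∑-map h []       f = refl
  ∑-map h (x ∷ xs) f = +-congˡ (∑-map h xs f)

  module _ {a b} {A : Set a} {B : Set b} where

    ∑-swap : (xs : List A) (ys : List B) (f : A → B → Carrier) →
             ∑[ x ∈ xs ] (∑[ y ∈ ys ] f x y) ≈ ∑[ y ∈ ys ] (∑[ x ∈ xs ] f x y)
    ∑-swap []       ys f = sym (∑-0 ys)
    ∑-swap (x ∷ xs) ys f = trans (+-congˡ (∑-swap xs ys f)) (sym (∑-+ ys (f x) _))

    ∑-cartesianProductWith : ∀ {c} {C : Set c} (h : A → B → C) (xs : List A) (ys : List B)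
      (f : C → Carrier) →
      ∑ (cartesianProductWith h xs ys) f ≈ ∑[ x ∈ xs ] (∑[ y ∈ ys ] f (h x y))
    ∑-cartesianProductWith h []       ys f = refl
    ∑-cartesianProductWith h (x ∷ xs) ys f =
      trans (∑-++ (map (h x) ys) (cartesianProductWith h xs ys) f)
            (+-cong (∑-map (h x) ys f) (∑-cartesianProductWith h xs ys f))

  module _ {a} {A : Set a} (_≟_ : DecidableEquality A) where

    ∑-absent : ∀ {y xs} → All (y ≢_) xs → (f : A → Carrier) →
               ∑[ x ∈ xs ] (𝟙 (y ≟ x) * f x) ≈ 0#
    ∑-absent                []          f = refl
    ∑-absent {y} {x ∷ xs} (y≢x ∷ y≢xs) f =
      trans (+-cong (trans (*-congʳ (𝟙-no (y ≟ x) y≢x)) (zeroˡ (f x))) (∑-absent y≢xs f))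
            (+-identityˡ 0#)

    -- Uniqueness of the list leaves a single nonzero term. Read from right to left with `y`
    -- depending on an outer index, it fibres a sum over the values of `y`; most double counting
    -- below starts this way.
    ∑-sift : ∀ {y xs} → Unique xs → y ∈ xs → (f : A → Carrier) →
             ∑[ x ∈ xs ] (𝟙 (y ≟ x) * f x) ≈ f y
    ∑-sift {y} (y≢xs ∷ _) (here ≡.refl) f =
      trans (+-cong (trans (*-congʳ (𝟙-yes (y ≟ y) ≡.refl)) (*-identityˡ (f y)))
                    (∑-absent y≢xs f))
            (+-identityʳ (f y))
    ∑-sift {y} {x ∷ _} (x≢xs ∷ !xs) (there y∈) f =
      trans (+-cong (trans (*-congʳ (𝟙-no (y ≟ x) λ { ≡.refl → All.lookup x≢xs y∈ ≡.refl }))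
                           (zeroˡ (f x)))
                    (∑-sift !xs y∈ f))
            (+-identityˡ (f y))

-- Fourier-Motzkin elimination and attained maxima of linear programs.

module LinearProgramming {c ℓ₁ ℓ₂} (𝔽 : OrderedField c ℓ₁ ℓ₂) where
  open OrderedField 𝔽
  open OrderedFieldProperties 𝔽

  module _ {p d t e : Carrier} (0≤p : 0# ≤ p) (0≤d : 0# ≤ d) (pd≈1 : p * d ≈ 1#) where

    private
      p[dt]≈t : ∀ t → p * (d * t) ≈ t
      p[dt]≈t t = trans (sym (*-assoc p d t)) (trans (*-congʳ pd≈1) (*-identityˡ t))

      d[pe]≈e : ∀ e → d * (p * e) ≈ e
      d[pe]≈e e = trans (sym (*-assoc d p e))
                        (trans (*-congʳ (trans (*-comm d p) pd≈1)) (*-identityˡ e))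

      neg : ∀ x → - (- p * x) ≈ p * x
      neg x = trans (-‿cong (sym (-‿distribˡ-* p x))) (-‿involutive (p * x))

    0≤dt+e⇒lower : 0# ≤ d * t + e → - p * e ≤ t
    0≤dt+e⇒lower 0≤dt+e = 0≤y-x⇒x≤y (≤-respʳ eq (*-nonNegative 0≤p 0≤dt+e))
      where
      eq : p * (d * t + e) ≈ t - (- p * e)
      eq = trans (distribˡ p (d * t) e) (+-cong (p[dt]≈t t) (sym (neg e)))

    lower⇒0≤dt+e : - p * e ≤ t → 0# ≤ d * t + e
    lower⇒0≤dt+e low = ≤-respʳ eq (*-nonNegative 0≤d (x≤y⇒0≤y-x low))
      where
      eq : d * (t - (- p * e)) ≈ d * t + e
      eq = trans (*-congˡ (+-congˡ (neg e)))
                 (trans (distribˡ d t (p * e)) (+-congˡ (d[pe]≈e e)))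

    -- Meant for a negative leading coefficient `q`, with `d` its negation and `p` the inverse of
    -- `d`. The equation `q ≈ - d` is a hypothesis because `q` and `- - q` agree only up to `≈`.
    0≤-dt+e⇒upper : ∀ {q} → q ≈ - d → 0# ≤ q * t + e → t ≤ p * e
    0≤-dt+e⇒upper {q} q≈-d 0≤qt+e = 0≤y-x⇒x≤y (≤-respʳ eq (*-nonNegative 0≤p 0≤qt+e))
      where
      eq : p * (q * t + e) ≈ p * e - t
      eq = begin-equality
        p * (q * t + e)        ≈⟨ distribˡ p (q * t) e ⟩
        p * (q * t) + p * e    ≈⟨ +-comm _ _ ⟩
        p * e + p * (q * t)    ≈⟨ +-congˡ (*-congˡ (*-congʳ q≈-d)) ⟩
        p * e + p * (- d * t)  ≈⟨ +-congˡ (*-congˡ (-‿distribˡ-* d t)) ⟨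
        p * e + p * - (d * t)  ≈⟨ +-congˡ (-‿distribʳ-* p (d * t)) ⟨
        p * e - p * (d * t)    ≈⟨ +-congˡ (-‿cong (p[dt]≈t t)) ⟩
        p * e - t              ∎

    upper⇒0≤-dt+e : ∀ {q} → q ≈ - d → t ≤ p * e → 0# ≤ q * t + e
    upper⇒0≤-dt+e {q} q≈-d up = ≤-respʳ eq (*-nonNegative 0≤d (x≤y⇒0≤y-x up))
      where
      eq : d * (p * e - t) ≈ q * t + e
      eq = begin-equality
        d * (p * e - t)        ≈⟨ distribˡ d (p * e) (- t) ⟩
        d * (p * e) + d * - t  ≈⟨ +-cong (d[pe]≈e e) (sym (-‿distribʳ-* d t)) ⟩
        e - d * t              ≈⟨ +-comm _ _ ⟩
        - (d * t) + e          ≈⟨ +-congʳ (-‿distribˡ-* d t) ⟩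
        - d * t + e            ≈⟨ +-congʳ (*-congʳ q≈-d) ⟨
        q * t + e              ∎

  AffineForm : ℕ → Set c
  AffineForm n = Vec Carrier n × Carrier

  eval : ∀ {n} → AffineForm n → Vec Carrier n → Carrier
  eval ([]     , k) []      = k
  eval (a ∷ as , k) (t ∷ x) = a * t + eval (as , k) x

  scale : ∀ {n} → Carrier → AffineForm n → AffineForm n
  scale s (as , k) = Vec.map (s *_) as , s * k

  eval-scale : ∀ {n} s (F : AffineForm n) x → eval (scale s F) x ≈ s * eval F x
  eval-scale s ([]     , k) []      = refl
  eval-scale s (a ∷ as , k) (t ∷ x) =
    trans (+-cong (*-assoc s a t) (eval-scale s (as , k) x)) (sym (distribˡ s _ _))

  _⊖_ : ∀ {n} → AffineForm n → AffineForm n → AffineForm n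
  (as , k) ⊖ (bs , l) = Vec.zipWith _-_ as bs , k - l

  eval-⊖ : ∀ {n} (F G : AffineForm n) x → eval (F ⊖ G) x ≈ eval F x - eval G x
  eval-⊖ ([]     , k) ([]     , l) []      = refl
  eval-⊖ (a ∷ as , k) (b ∷ bs , l) (t ∷ x) = begin-equality
    (a - b) * t + eval ((as , k) ⊖ (bs , l)) x
      ≈⟨ +-cong (distribʳ t a (- b)) (eval-⊖ (as , k) (bs , l) x) ⟩
    (a * t + - b * t) + (eval (as , k) x - eval (bs , l) x)
      ≈⟨ Solver.solve 4 (λ p q r s → (p Solver.:+ q) Solver.:+ (r Solver.:+ s)
           Solver.:= (p Solver.:+ r) Solver.:+ (q Solver.:+ s)) refl _ _ _ _ ⟩
    (a * t + eval (as , k) x) + (- b * t + - eval (bs , l) x)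
      ≈⟨ +-congˡ (+-congʳ (-‿distribˡ-* b t)) ⟨
    (a * t + eval (as , k) x) + (- (b * t) + - eval (bs , l) x)
      ≈⟨ +-congˡ (-‿+-comm (b * t) (eval (bs , l) x)) ⟩
    (a * t + eval (as , k) x) - (b * t + eval (bs , l) x)
      ∎

  Satisfies : ∀ {n} → List (AffineForm n) → Vec Carrier n → Set _
  Satisfies S x = All (λ F → 0# ≤ eval F x) S

  -- Solves every inequality for the first coordinate `t`, according to the sign of its coefficient.
  -- For fixed `x` the system says that `t` lies in an interval whose endpoints are affine in `x`,
  -- plus conditions on `x` alone.
  record Split {n} (S : List (AffineForm (suc n))) : Set (c Level.⊔ ℓ₂) where
    field
      lowers uppers frees : List (AffineForm n)
    Bounds : Carrier → Vec Carrier n → Set _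
    Bounds t x = All (λ L → eval L x ≤ t) lowers × All (λ U → t ≤ eval U x) uppers ×
                 Satisfies frees x
    field
      to   : ∀ t x → Satisfies S (t ∷ x) → Bounds t x
      from : ∀ t x → Bounds t x → Satisfies S (t ∷ x)

  split : ∀ {n} (S : List (AffineForm (suc n))) → Split S
  split [] = record
    { lowers = [] ; uppers = [] ; frees = []
    ; to   = λ _ _ _ → [] , [] , []
    ; from = λ _ _ _ → []
    }
  split ((a ∷ as , k) ∷ S) with a ≈? 0#
  ... | yes a≈0 = record
    { lowers = lowers ; uppers = uppers ; frees = (as , k) ∷ frees
    ; to   = λ where t x (s ∷ ss) → let l , u , f = to t x ss in
                                     l , u , ≤-respʳ (vanish t x) s ∷ f
    ; from = λ where t x (l , u , f ∷ fs) → ≤-respʳ (sym (vanish t x)) f ∷ from t x (l , u , fs)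
    }
    where
    open Split (split S)
    vanish : ∀ t x → a * t + eval (as , k) x ≈ eval (as , k) x
    vanish t x = trans (+-congʳ (trans (*-congʳ a≈0) (zeroˡ t))) (+-identityˡ _)
  ... | no a≉0 with ≤-total 0# a
  ...   | inj₁ 0≤a = record
    { lowers = scale (- (a ⁻¹)) (as , k) ∷ lowers ; uppers = uppers ; frees = frees
    ; to   = λ where
        t x (s ∷ ss) → let l , u , f = to t x ss in
          ≤-respˡ (sym (eval-scale (- (a ⁻¹)) (as , k) x))
                  (0≤dt+e⇒lower 0≤a⁻¹ 0≤a a⁻¹a≈1 s) ∷ l , u , f
    ; from = λ where
        t x (l ∷ ls , u , f) →
          lower⇒0≤dt+e 0≤a⁻¹ 0≤a a⁻¹a≈1
            (≤-respˡ (eval-scale (- (a ⁻¹)) (as , k) x) l) ∷ from t x (ls , u , f)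
    }
    where
    open Split (split S)
    0<a : 0# < a
    0<a = 0≤a , λ 0≈a → a≉0 (sym 0≈a)
    0≤a⁻¹ = ⁻¹-nonNegative 0<a
    a⁻¹a≈1 = *-inverseˡ 0<a
  ...   | inj₂ a≤0 = record
    { lowers = lowers ; uppers = scale ((- a) ⁻¹) (as , k) ∷ uppers ; frees = frees
    ; to   = λ where
        t x (s ∷ ss) → let l , u , f = to t x ss in
          l , ≤-respʳ (sym (eval-scale ((- a) ⁻¹) (as , k) x))
                      (0≤-dt+e⇒upper 0≤p (proj₁ 0<-a) pd≈1 a≈--a s) ∷ u , f
    ; from = λ where
        t x (l , u ∷ us , f) →
          upper⇒0≤-dt+e 0≤p (proj₁ 0<-a) pd≈1 a≈--a
            (≤-respʳ (eval-scale ((- a) ⁻¹) (as , k) x) u) ∷ from t x (l , us , f)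
    }
    where
    open Split (split S)
    a≈--a : a ≈ - - a
    a≈--a = sym (-‿involutive a)
    0<-a : 0# < - a
    0<-a = ≤-respˡ -0#≈0# (neg-antimono-≤ a≤0) ,
           λ 0≈-a → a≉0 (trans a≈--a (trans (-‿cong (sym 0≈-a)) -0#≈0#))
    0≤p = ⁻¹-nonNegative 0<-a
    pd≈1 = *-inverseˡ 0<-a

  module _ {a} {A : Set a} (f : A → Carrier) where

    -- `m` is the minimum of `B` and the values `f u`, given by its universal property. The cap `B`
    -- makes it exist when there are no upper endpoints.
    greatestBelow : ∀ B us → ∃[ m ] m ≤ B × All (λ u → m ≤ f u) us ×
                             (∀ l → l ≤ B → All (λ u → l ≤ f u) us → l ≤ m)
    greatestBelow B []       = B , ≤-refl , [] , λ l l≤B _ → l≤B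
    greatestBelow B (u ∷ us) with greatestBelow B us
    ... | m , m≤B , m≤us , max with ≤-total m (f u)
    ...   | inj₁ m≤u = m , m≤B , m≤u ∷ m≤us , λ where l l≤B (_ ∷ l≤us) → max l l≤B l≤us
    ...   | inj₂ u≤m = f u , ≤-trans u≤m m≤B , ≤-refl ∷ All.map (≤-trans u≤m) m≤us ,
                       λ where l _ (l≤u ∷ _) → l≤u

    someAbove : ∀ ls → ∃[ M ] All (λ l → f l ≤ M) ls
    someAbove []       = 0# , []
    someAbove (l ∷ ls) with someAbove ls
    ... | M , ls≤M with ≤-total M (f l)
    ...   | inj₁ M≤l = f l , ≤-refl ∷ All.map (λ l≤M → ≤-trans l≤M M≤l) ls≤M
    ...   | inj₂ l≤M = M , l≤M ∷ ls≤M

  -- In a total order, finitely many lower and upper bounds leave room for a common `t` exactly when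
  -- each lower bound is at most each upper bound. The pairwise differences state this without `t`,
  -- so `S′` describes the projection of the solution set exactly.
  eliminate : ∀ {n} (S : List (AffineForm (suc n))) → ∃[ S′ ]
              (∀ t x → Satisfies S (t ∷ x) → Satisfies S′ x) ×
              (∀ x → Satisfies S′ x → ∃[ t ] Satisfies S (t ∷ x))
  eliminate {n} S = S′ , project , extend
    where
    open Split (split S)

    differences S′ : List (AffineForm n)
    differences = cartesianProductWith (λ L U → U ⊖ L) lowers uppers
    S′ = frees ++ differences

    project : ∀ t x → Satisfies S (t ∷ x) → Satisfies S′ x
    project t x sat with to t x sat
    ... | ls≤t , t≤us , fs = Allₚ.++⁺ fs (All.tabulate pos)
      where
      pos : ∀ {F} → F ∈ differences → 0# ≤ eval F x
      pos F∈ with ∈-cartesianProductWith⁻ (λ L U → U ⊖ L) lowers uppers F∈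
      ... | L , U , L∈ , U∈ , ≡.refl = ≤-respʳ (sym (eval-⊖ U L x))
        (x≤y⇒0≤y-x (≤-trans (All.lookup ls≤t L∈) (All.lookup t≤us U∈)))

    extend : ∀ x → Satisfies S′ x → ∃[ t ] Satisfies S (t ∷ x)
    -- The witness `t` is the smallest upper endpoint, capped by some `M` above all lower endpoints.
    -- Each lower endpoint is below `M` and below every upper endpoint, hence below `t`.
    extend x sat with someAbove (λ L → eval L x) lowers
    ... | M , ls≤M with greatestBelow (λ U → eval U x) M uppers
    ...   | t , _ , t≤us , max = t , from t x (All.tabulate below , t≤us , Allₚ.++⁻ˡ frees sat)
      where
      below : ∀ {L} → L ∈ lowers → eval L x ≤ t
      below {L} L∈ = max (eval L x) (All.lookup ls≤M L∈) (All.tabulate λ {U} U∈ →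
        0≤y-x⇒x≤y (≤-respʳ (eval-⊖ U L x) (All.lookup (Allₚ.++⁻ʳ frees sat)
          (∈-cartesianProductWith⁺ (λ L U → U ⊖ L) L∈ U∈))))

  -- The objective sits in the last coordinate so that eliminating heads never touches it. What
  -- remains is a system in one variable, whose maximum is a minimum of finitely many endpoints;
  -- `extend` then rebuilds the other coordinates one at a time.
  lastCoordinateMaximum : ∀ n (S : List (AffineForm (n +ₙ 1))) B →
    ∃₂ (λ (x : Vec Carrier n) w → Satisfies S (x Vec.++ w ∷ [])) →
    (∀ (x : Vec Carrier n) w → Satisfies S (x Vec.++ w ∷ []) → w ≤ B) →
    ∃[ m ] ∃ (λ (x : Vec Carrier n) → Satisfies S (x Vec.++ m ∷ [])) ×
           (∀ (x : Vec Carrier n) w → Satisfies S (x Vec.++ w ∷ []) → w ≤ m)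
  lastCoordinateMaximum zero S B ([] , w₀ , sat₀) bounded
    with greatestBelow (λ U → eval U []) B (Split.uppers (split S))
  ... | m , m≤B , m≤us , max = m , ([] , from m [] (ls≤m , m≤us , fs)) , below
    where
    open Split (split S)
    below : ∀ (x : Vec Carrier 0) w → Satisfies S (x Vec.++ w ∷ []) → w ≤ m
    below [] w sat = max w (bounded [] w sat) (proj₁ (proj₂ (to w [] sat)))
    -- The known solution `w₀` shows that the interval is nonempty: lower endpoints lie below `w₀`,
    -- and `w₀` lies below `m`.
    ls≤m : All (λ L → eval L [] ≤ m) lowers
    ls≤m = All.map (λ l≤w₀ → ≤-trans l≤w₀ (below [] w₀ sat₀)) (proj₁ (to w₀ [] sat₀))
    fs : Satisfies frees []
    fs = proj₂ (proj₂ (to w₀ [] sat₀))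
  lastCoordinateMaximum (suc n) S B (t₀ ∷ x₀ , w₀ , sat₀) bounded with eliminate S
  ... | S′ , project , extend
    with lastCoordinateMaximum n S′ B (x₀ , w₀ , project t₀ _ sat₀)
           (λ x w sat → let t , sat′ = extend _ sat in bounded (t ∷ x) w sat′)
  ...   | m , (x , sat) , max = m , (let t , sat′ = extend _ sat in t ∷ x , sat′) ,
                                λ where (t ∷ x) w sat → max x w (project t _ sat)

  module _ {A : Set} (L : Listing A) (_≟_ : DecidableEquality A) where
    open Listing L

    Constraint : Set c
    Constraint = (A → Carrier) × Carrier

    record Admissible (K : List Constraint) (b : A → Carrier) : Set (c Level.⊔ ℓ₂) where
      constructor _,_
      field
        nonNegative : ∀ a → 0# ≤ b a
        satisfied   : All (λ (f , k) → ∑[ a ∈ elements ] (f a * b a) ≤ k) K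

    private
      pairing : (A → Carrier) → (xs : List A) → Vec Carrier (length xs) → Carrier
      pairing f []       []      = 0#
      pairing f (a ∷ xs) (t ∷ x) = f a * t + pairing f xs x

      coefficients : (A → Carrier) → Carrier → (xs : List A) → Vec Carrier (length xs +ₙ 1)
      coefficients f s []       = s ∷ []
      coefficients f s (a ∷ xs) = f a ∷ coefficients f s xs

      eval-coefficients : ∀ f s k xs x w →
        eval (coefficients f s xs , k) (x Vec.++ w ∷ []) ≈ pairing f xs x + (s * w + k)
      eval-coefficients f s k []       []      w = sym (+-identityˡ _)
      eval-coefficients f s k (a ∷ xs) (t ∷ x) w =
        trans (+-congˡ (eval-coefficients f s k xs x w)) (sym (+-assoc _ _ _))

      values : (A → Carrier) → (xs : List A) → Vec Carrier (length xs)
      values b []       = []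
      values b (a ∷ xs) = b a ∷ values b xs

      pairing-values : ∀ f b xs → pairing f xs (values b xs) ≈ ∑[ a ∈ xs ] (f a * b a)
      pairing-values f b []       = refl
      pairing-values f b (a ∷ xs) = +-congˡ (pairing-values f b xs)

      -- Reads a vector of coordinates as a function on `A`. Written as a linear functional of `x`,
      -- it turns nonnegativity at `h` into one more affine inequality, `atLeast0 h`.
      weightAt : (xs : List A) → Vec Carrier (length xs) → A → Carrier
      weightAt xs x h = pairing (λ a → 𝟙 (a ≟ h)) xs x

      ∑-weightAt : ∀ f xs x → ∑[ h ∈ elements ] (f h * weightAt xs x h) ≈ pairing f xs x
      ∑-weightAt f []       []      = trans (∑-cong elements (λ h → zeroʳ (f h))) (∑-0 elements)
      ∑-weightAt f (a ∷ xs) (t ∷ x) = begin-equality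
        ∑[ h ∈ elements ] (f h * (𝟙 (a ≟ h) * t + weightAt xs x h))
          ≈⟨ ∑-cong elements (λ h → Solver.solve 4 (λ f i t r →
               f Solver.:* (i Solver.:* t Solver.:+ r)
               Solver.:= i Solver.:* (f Solver.:* t) Solver.:+ f Solver.:* r)
               refl (f h) (𝟙 (a ≟ h)) t (weightAt xs x h)) ⟩
        ∑[ h ∈ elements ] (𝟙 (a ≟ h) * (f h * t) + f h * weightAt xs x h)
          ≈⟨ ∑-+ elements _ _ ⟩
        ∑[ h ∈ elements ] (𝟙 (a ≟ h) * (f h * t)) + ∑[ h ∈ elements ] (f h * weightAt xs x h)
          ≈⟨ +-cong (∑-sift _≟_ unique (complete a) (λ h → f h * t)) (∑-weightAt f xs x) ⟩
        f a * t + pairing f xs x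
          ∎

      neg-∑ : (f b : A → Carrier) (xs : List A) →
              ∑[ a ∈ xs ] (- f a * b a) ≈ - (∑[ a ∈ xs ] (f a * b a))
      neg-∑ f b []       = sym -0#≈0#
      neg-∑ f b (a ∷ xs) = trans (+-cong (sym (-‿distribˡ-* (f a) (b a))) (neg-∑ f b xs))
                                 (-‿+-comm _ _)

    totalMaximum : ∀ (K : List Constraint) B → ∃ (Admissible K) →
      (∀ b → Admissible K b → ∑ elements b ≤ B) →
      ∃ (IsMaximum (λ w → ∃[ b ] Admissible K b × ∑ elements b ≈ w))
    totalMaximum K B (b₀ , adm₀) bounded = m , (b , adm , ∑b≈m) , below
      where
      objective : AffineForm (length elements +ₙ 1)
      objective = coefficients (λ _ → 1#) (- 1#) elements , 0#

      atLeast0 : A → AffineForm (length elements +ₙ 1)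
      atLeast0 h = coefficients (λ a → 𝟙 (a ≟ h)) 0# elements , 0#

      atMost : Constraint → AffineForm (length elements +ₙ 1)
      atMost (f , k) = coefficients (λ a → - f a) 0# elements , k

      -- The objective is relaxed to w ≤ ∑ b; at the maximal w it is attained with equality.
      S : List (AffineForm (length elements +ₙ 1))
      S = objective ∷ map atLeast0 elements ++ map atMost K

      module _ (x : Vec Carrier (length elements)) (w : Carrier) where

        -- The hypothesis says only that `x` and `b` pair alike with every `f`. It holds both for
        -- the vector of values of a function and for the function `weightAt` of a vector, so one
        -- computation serves both translations.
        objective-eval : ∀ b → (∀ f → pairing f elements x ≈ ∑[ a ∈ elements ] (f a * b a)) →
                         eval objective (x Vec.++ w ∷ []) ≈ ∑ elements b - w
        objective-eval b eq = begin-equality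
          eval objective (x Vec.++ w ∷ [])
            ≈⟨ eval-coefficients _ _ _ elements x w ⟩
          pairing (λ _ → 1#) elements x + (- 1# * w + 0#)
            ≈⟨ +-cong (trans (eq _) (∑-cong elements λ a → *-identityˡ (b a)))
                      (trans (+-identityʳ _)
                             (trans (sym (-‿distribˡ-* 1# w)) (-‿cong (*-identityˡ w)))) ⟩
          ∑ elements b - w
            ∎

        atLeast0-eval : ∀ h → eval (atLeast0 h) (x Vec.++ w ∷ []) ≈ weightAt elements x h
        atLeast0-eval h = begin-equality
          eval (atLeast0 h) (x Vec.++ w ∷ [])       ≈⟨ eval-coefficients _ _ _ elements x w ⟩
          weightAt elements x h + (0# * w + 0#)     ≈⟨ +-congˡ (trans (+-identityʳ _) (zeroˡ w)) ⟩
          weightAt elements x h + 0#                ≈⟨ +-identityʳ _ ⟩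
          weightAt elements x h                     ∎

        atMost-eval : ∀ b → (∀ f → pairing f elements x ≈ ∑[ a ∈ elements ] (f a * b a)) →
          ∀ f k → eval (atMost (f , k)) (x Vec.++ w ∷ []) ≈ k - (∑[ a ∈ elements ] (f a * b a))
        atMost-eval b eq f k = begin-equality
          eval (atMost (f , k)) (x Vec.++ w ∷ [])
            ≈⟨ eval-coefficients _ _ _ elements x w ⟩
          pairing (λ a → - f a) elements x + (0# * w + k)
            ≈⟨ +-cong (trans (eq _) (neg-∑ f b elements))
                      (trans (+-congʳ (zeroˡ w)) (+-identityˡ k)) ⟩
          - (∑[ a ∈ elements ] (f a * b a)) + k
            ≈⟨ +-comm _ _ ⟩
          k - (∑[ a ∈ elements ] (f a * b a))
            ∎

      satisfies : ∀ b w → Admissible K b → w ≤ ∑ elements b →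
                  Satisfies S (values b elements Vec.++ w ∷ [])
      satisfies b w (0≤b , sat) w≤ =
        ≤-respʳ (sym (objective-eval x w b eq)) (x≤y⇒0≤y-x w≤) ∷
        Allₚ.++⁺
          (Allₚ.map⁺ (All.tabulate λ {h} _ →
            ≤-respʳ (sym (trans (atLeast0-eval x w h) (pairing-values _ b elements)))
              (∑-nonNegative elements λ a → *-nonNegative (𝟙-nonNegative (a ≟ h)) (0≤b a))))
          (Allₚ.map⁺ (All.map (λ {(f , k)} ≤k →
            ≤-respʳ (sym (atMost-eval x w b eq f k)) (x≤y⇒0≤y-x ≤k)) sat))
        where
        x = values b elements
        eq : ∀ f → pairing f elements x ≈ ∑[ a ∈ elements ] (f a * b a)
        eq f = pairing-values f b elements

      module _ (x : Vec Carrier (length elements)) (w : Carrier)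
               (sat : Satisfies S (x Vec.++ w ∷ [])) where

        private
          eq : ∀ f → pairing f elements x ≈ ∑[ a ∈ elements ] (f a * weightAt elements x a)
          eq f = sym (∑-weightAt f elements x)

        admissible : Admissible K (weightAt elements x)
        admissible =
          (λ h → ≤-respʳ (atLeast0-eval x w h)
            (All.lookup (Allₚ.map⁻ (Allₚ.++⁻ˡ (map atLeast0 elements) (All.tail sat)))
                        (complete h))) ,
          All.map (λ {(f , k)} 0≤ → 0≤y-x⇒x≤y (≤-respʳ (atMost-eval x w _ eq f k) 0≤))
            (Allₚ.map⁻ (Allₚ.++⁻ʳ (map atLeast0 elements) (All.tail sat)))

        last≤total : w ≤ ∑ elements (weightAt elements x)
        last≤total = 0≤y-x⇒x≤y (≤-respʳ (objective-eval x w _ eq) (All.head sat))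

      optimum = lastCoordinateMaximum (length elements) S B
        (values b₀ elements , ∑ elements b₀ , satisfies b₀ _ adm₀ ≤-refl)
        (λ x w sat → ≤-trans (last≤total x w sat) (bounded _ (admissible x w sat)))

      m = proj₁ optimum
      x* = proj₁ (proj₁ (proj₂ optimum))
      sat* = proj₂ (proj₁ (proj₂ optimum))

      b : A → Carrier
      b = weightAt elements x*

      adm : Admissible K b
      adm = admissible x* m sat*

      total≤m : ∀ b → Admissible K b → ∑ elements b ≤ m
      total≤m b adm = proj₂ (proj₂ optimum) _ _ (satisfies b _ adm ≤-refl)

      ∑b≈m : ∑ elements b ≈ m
      ∑b≈m = ≤-antisym (total≤m b adm) (last≤total x* m sat*)

      below : ∀ w → ∃[ b ] Admissible K b × ∑ elements b ≈ w → w ≤ m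
      below w (b , adm , ∑b≈w) = ≤-respˡ ∑b≈w (total≤m b adm)

-- Tuples.

lookup-fromFunction : ∀ {n} {d : Fin n → ℕ} (f : (j : Fin n) → Fin (d j)) (j : Fin n) →
                      lookup {d = d} (fromFunction f) j ≡ f j
lookup-fromFunction f zero    = ≡.refl
lookup-fromFunction f (suc j) = lookup-fromFunction (f ∘ suc) j

fromFunction-cong : ∀ {n} {d : Fin n → ℕ} {f g : (j : Fin n) → Fin (d j)} →
                    (∀ j → f j ≡ g j) → fromFunction {d = d} f ≡ fromFunction g
fromFunction-cong {zero}  f≗g = ≡.refl
fromFunction-cong {suc n} f≗g = ≡.cong₂ _,_ (f≗g zero) (fromFunction-cong (f≗g ∘ suc))

tupleListing : ∀ {n} (d : Fin n → ℕ) → Listing (Tuple d)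
tupleListing d = record { elements = allTuples d ; complete = complete ; unique = unique d }
  where
  complete : ∀ {n} {d : Fin n → ℕ} (t : Tuple d) → t ∈ allTuples d
  complete {zero}  tt      = here ≡.refl
  complete {suc n} (a , t) = ∈-cartesianProductWith⁺ _,_ (∈-allFin a) (complete t)

  unique : ∀ {n} (d : Fin n → ℕ) → Unique (allTuples d)
  unique {zero}  d = [] ∷ []
  unique {suc n} d = Uniqueₚ.cartesianProductWith⁺ _,_ ,-injective
                       (Uniqueₚ.allFin⁺ (d zero)) (unique (d ∘ suc))

-- Weights on the global assignments of an empirical model.

module EmpiricalModelProperties {c ℓ₁ ℓ₂} {𝔽 : OrderedField c ℓ₁ ℓ₂} (e : EmpiricalModel 𝔽) where
  open OrderedField 𝔽
  open OrderedFieldProperties 𝔽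
  open LinearProgramming 𝔽
  open EmpiricalModel e

  private
    ∷-injective : ∀ {o os} {a b : Outcome o} {g h : All Outcome os} →
                  _≡_ {A = All Outcome (o ∷ os)} (a ∷ g) (b ∷ h) → a ≡ b × g ≡ h
    ∷-injective ≡.refl = ≡.refl , ≡.refl

  _≟ₐ_ : ∀ {os} → DecidableEquality (All Outcome os)
  []      ≟ₐ []      = yes ≡.refl
  (a ∷ g) ≟ₐ (b ∷ h) = map′ (λ { (≡.refl , ≡.refl) → ≡.refl }) ∷-injective ((a ≟ b) ×-dec (g ≟ₐ h))

  assignmentListing : (os : List Obs) → Listing (All Outcome os)
  assignmentListing os = record
    { elements = assignmentsOn os ; complete = complete ; unique = unique os }
    where
    complete : ∀ {os} (g : All Outcome os) → g ∈ assignmentsOn os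
    complete []      = here ≡.refl
    complete (a ∷ g) = ∈-cartesianProductWith⁺ _∷_ (∈-allFin a) (complete g)

    unique : ∀ os → Unique (assignmentsOn os)
    unique []       = [] ∷ []
    unique (o ∷ os) = Uniqueₚ.cartesianProductWith⁺ _∷_ ∷-injective
                        (Uniqueₚ.allFin⁺ (#outcomes o)) (unique os)

  globalListing : Listing GlobalAssignment
  globalListing = assignmentListing (Listing.elements obsListing)

  _at_ : GlobalAssignment → (o : Obs) → Outcome o
  g at o = All.lookup g (Listing.complete obsListing o)

  assignment : ((o : Obs) → Outcome o) → GlobalAssignment
  assignment f = All.universal f (Listing.elements obsListing)

  assignment-at : ∀ f o → assignment f at o ≡ f o
  assignment-at f o = lookup-universal (Listing.complete obsListing o)
    where
    lookup-universal : ∀ {o os} (o∈ : o ∈ os) → All.lookup (All.universal f os) o∈ ≡ f o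
    lookup-universal (here ≡.refl) = ≡.refl
    lookup-universal (there o∈)    = lookup-universal o∈

  -- For functions of the form `g at_` this is `restrict g` by definition, so events of honest
  -- global assignments and of functional valuations share their lemmas.
  marginal : ((o : Obs) → Outcome o) → (C : Ctx) → LocalOutcome C
  marginal f C = fromFunction (λ i → f (obsAt C i))

  marginal? : ∀ f C (u : LocalOutcome C) → Dec (marginal f C ≡ u)
  marginal? f C u = marginal f C ≟ₜ u

  restrict-assignment : ∀ f C → restrict (assignment f) C ≡ marginal f C
  restrict-assignment f C = fromFunction-cong (λ i → assignment-at f (obsAt C i))

  localOutcomes : (C : Ctx) → List (LocalOutcome C)
  localOutcomes C = allTuples (#outcomes ∘ obsAt C)

  mass : (GlobalAssignment → Carrier) → (C : Ctx) → LocalOutcome C → Carrier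
  mass b C u = ∑[ g ∈ globalAssignments ] (𝟙 (restrict g C ≟ₜ u) * b g)

  ∑-filter-mass : ∀ b C u →
    sumOver (filter (λ g → restrict g C ≟ₜ u) globalAssignments) b ≈ mass b C u
  ∑-filter-mass b C u = ∑-filter (λ g → restrict g C ≟ₜ u) globalAssignments b

  feasible : ∀ {b} → (∀ g → 0# ≤ b g) → (∀ C u → mass b C u ≤ table C u) → IsFeasible 𝔽 e b
  feasible {b} 0≤b bounded = record
    { nonNegative = 0≤b
    ; bounded     = λ C u → ≤-respˡ (sym (∑-filter-mass b C u)) (bounded C u)
    }

  mass≤table : ∀ {b} → IsFeasible 𝔽 e b → ∀ C u → mass b C u ≤ table C u
  mass≤table {b} feas C u = ≤-respˡ (∑-filter-mass b C u) (IsFeasible.bounded feas C u)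

  weight≤table : ∀ {b} → IsFeasible 𝔽 e b → ∀ C g → b g ≤ table C (restrict g C)
  weight≤table {b} feas C g = begin
    b g                                              ≈⟨ *-identityˡ (b g) ⟨
    1# * b g                                         ≈⟨ *-congʳ (𝟙-yes (restrict g C ≟ₜ _) ≡.refl) ⟨
    𝟙 (restrict g C ≟ₜ restrict g C) * b g           ≤⟨ ∑-∈ nonNeg (complete g) ⟩
    mass b C (restrict g C)                          ≤⟨ mass≤table feas C (restrict g C) ⟩
    table C (restrict g C)                           ∎
    where
    open Listing globalListing using (complete)
    nonNeg : ∀ h → 0# ≤ 𝟙 (restrict h C ≟ₜ restrict g C) * b h
    nonNeg h = *-nonNegative (𝟙-nonNegative (restrict h C ≟ₜ _)) (IsFeasible.nonNegative feas h)

  -- The events `restrict g C ≡ u` partition the global assignments. Hence every context bounds the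
  -- total of a feasible weight by the sum of its table.
  ∑-mass : ∀ b C → ∑[ u ∈ localOutcomes C ] mass b C u ≈ ∑ globalAssignments b
  ∑-mass b C = trans (∑-swap (localOutcomes C) globalAssignments _)
    (∑-cong globalAssignments λ g →
      ∑-sift _≟ₜ_ (Listing.unique (tupleListing _))
             (Listing.complete (tupleListing _) (restrict g C)) (λ _ → b g))

  total≤∑table : ∀ {b} → IsFeasible 𝔽 e b → ∀ C →
                 ∑ globalAssignments b ≤ ∑ (localOutcomes C) (table C)
  total≤∑table {b} feas C =
    ≤-respˡ (∑-mass b C) (∑-mono (localOutcomes C) (mass≤table feas C))

  module Pushforward {I : Set} (is : List I) (w : I → Carrier) (φ : I → (o : Obs) → Outcome o) where

    -- The image of `w` under `φ`. Weights are built on index sets suited to each construction, and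
    -- feasibility is checked there, where `φ i` is a plain function with definitional values.
    pushforward : GlobalAssignment → Carrier
    pushforward g = ∑[ i ∈ is ] (𝟙 (assignment (φ i) ≟ₐ g) * w i)

    ∑-pushforward : (F : GlobalAssignment → Carrier) →
      ∑[ g ∈ globalAssignments ] (F g * pushforward g) ≈ ∑[ i ∈ is ] (F (assignment (φ i)) * w i)
    ∑-pushforward F = begin-equality
      ∑[ g ∈ globalAssignments ] (F g * pushforward g)
        ≈⟨ ∑-cong globalAssignments (λ g → ∑-*ˡ is (F g) _) ⟨
      ∑[ g ∈ globalAssignments ] ∑[ i ∈ is ] (F g * (𝟙 (assignment (φ i) ≟ₐ g) * w i))
        ≈⟨ ∑-swap globalAssignments is _ ⟩
      ∑[ i ∈ is ] ∑[ g ∈ globalAssignments ] (F g * (𝟙 (assignment (φ i) ≟ₐ g) * w i))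
        ≈⟨ ∑-cong is (λ i → ∑-cong globalAssignments λ g →
             Solver.solve 3 (λ f d w →
               let open Solver in f :* (d :* w) := d :* (f :* w))
               refl (F g) (𝟙 (assignment (φ i) ≟ₐ g)) (w i)) ⟩
      ∑[ i ∈ is ] ∑[ g ∈ globalAssignments ] (𝟙 (assignment (φ i) ≟ₐ g) * (F g * w i))
        ≈⟨ ∑-cong is (λ i → ∑-sift _≟ₐ_ (Listing.unique globalListing)
             (Listing.complete globalListing (assignment (φ i))) (λ g → F g * w i)) ⟩
      ∑[ i ∈ is ] (F (assignment (φ i)) * w i)
        ∎

    total-pushforward : ∑ globalAssignments pushforward ≈ ∑ is w
    total-pushforward = begin-equality
      ∑ globalAssignments pushforward
        ≈⟨ ∑-cong globalAssignments (λ g → *-identityˡ (pushforward g)) ⟨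
      ∑[ g ∈ globalAssignments ] (1# * pushforward g)  ≈⟨ ∑-pushforward (λ _ → 1#) ⟩
      ∑[ i ∈ is ] (1# * w i)                           ≈⟨ ∑-cong is (λ i → *-identityˡ (w i)) ⟩
      ∑ is w                                           ∎

    mass-pushforward : ∀ C u →
      mass pushforward C u ≈ ∑[ i ∈ is ] (𝟙 (marginal? (φ i) C u) * w i)
    mass-pushforward C u = trans (∑-pushforward (λ g → 𝟙 (restrict g C ≟ₜ u)))
      (∑-cong is λ i → *-congʳ (reflexive
        (≡.cong (λ t → 𝟙 (t ≟ₜ u)) (restrict-assignment (φ i) C))))

    pushforward-feasible : (∀ i → 0# ≤ w i) →
      (∀ C u → ∑[ i ∈ is ] (𝟙 (marginal? (φ i) C u) * w i) ≤ table C u) →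
      IsFeasible 𝔽 e pushforward
    pushforward-feasible 0≤w bounded = feasible
      (λ g → ∑-nonNegative is λ i → *-nonNegative (𝟙-nonNegative (assignment (φ i) ≟ₐ g)) (0≤w i))
      (λ C u → ≤-respˡ (sym (mass-pushforward C u)) (bounded C u))

  -- The hypotheses are what the linear program needs to have an optimum: nonnegative tables make
  -- the zero weight feasible, and `B` bounds the objective.
  ncf-exists : (∀ C u → 0# ≤ table C u) → ∀ B →
    (∀ b → IsFeasible 𝔽 e b → ∑ globalAssignments b ≤ B) → ∃ (IsNCF 𝔽 e)
  ncf-exists 0≤table B bounded = transfer
    (totalMaximum globalListing _≟ₐ_ constraints B ((λ _ → 0#) , zero-admissible)
      (λ b adm → bounded b (toFeasible adm)))
    where
    constraint : (C : Ctx) → LocalOutcome C → Constraint globalListing _≟ₐ_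
    constraint C u = (λ g → 𝟙 (restrict g C ≟ₜ u)) , table C u

    constraintsAt : Ctx → List (Constraint globalListing _≟ₐ_)
    constraintsAt C = map (constraint C) (localOutcomes C)

    constraints : List (Constraint globalListing _≟ₐ_)
    constraints = concat (map constraintsAt (Listing.elements ctxListing))

    allConstraints : ∀ {p} {P : Constraint globalListing _≟ₐ_ → Set p} →
                     (∀ C u → P (constraint C u)) → All P constraints
    allConstraints p = Allₚ.concat⁺ (Allₚ.map⁺ (All.universal
      (λ C → Allₚ.map⁺ (All.universal (p C) (localOutcomes C))) (Listing.elements ctxListing)))

    toFeasible : ∀ {b} → Admissible globalListing _≟ₐ_ constraints b → IsFeasible 𝔽 e b
    toFeasible (0≤b , sat) = feasible 0≤b λ C u →
      All.lookup (Allₚ.map⁻ (All.lookup (Allₚ.map⁻ {f = constraintsAt} (Allₚ.concat⁻ sat))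
                                        (Listing.complete ctxListing C)))
                 (Listing.complete (tupleListing _) u)

    fromFeasible : ∀ {b} → IsFeasible 𝔽 e b → Admissible globalListing _≟ₐ_ constraints b
    fromFeasible feas = IsFeasible.nonNegative feas , allConstraints (mass≤table feas)

    zero-admissible : Admissible globalListing _≟ₐ_ constraints (λ _ → 0#)
    zero-admissible = (λ _ → ≤-refl) , allConstraints λ C u →
      ≤-respˡ (sym (trans (∑-cong globalAssignments (λ g → zeroʳ _)) (∑-0 globalAssignments)))
              (0≤table C u)

    transfer : ∃ (IsMaximum (λ w → ∃[ b ] Admissible globalListing _≟ₐ_ constraints b ×
                                          ∑ globalAssignments b ≈ w)) → ∃ (IsNCF 𝔽 e)
    transfer (m , (b , adm , ∑b≈m) , max) =
      m , (b , toFeasible adm , ∑b≈m) ,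
      λ w (b′ , feas , ∑b′≈w) → max w (b′ , fromFeasible feas , ∑b′≈w)

  module ProductMeasure (ρ : (o : Obs) → Outcome o → Carrier)
                        (ρ-normalised : ∀ o → ∑ (allFin (#outcomes o)) (ρ o) ≈ 1#) where

    weight : ∀ {os} → All Outcome os → Carrier
    weight []              = 1#
    weight (_∷_ {x = o} a h) = ρ o a * weight h

    weight-nonNegative : (∀ o a → 0# ≤ ρ o a) → ∀ {os} (h : All Outcome os) → 0# ≤ weight h
    weight-nonNegative 0≤ρ []      = 0≤1
    weight-nonNegative 0≤ρ (a ∷ h) = *-nonNegative (0≤ρ _ a) (weight-nonNegative 0≤ρ h)

    expectation : ∀ {os} → (All Outcome os → Carrier) → Carrier
    expectation {os} F = ∑[ h ∈ assignmentsOn os ] (F h * weight h)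

    expectation-∷ : ∀ {o os} (F : All Outcome (o ∷ os) → Carrier) →
      expectation F ≈ ∑[ a ∈ allFin (#outcomes o) ] (ρ o a * expectation (λ h → F (a ∷ h)))
    expectation-∷ {o} {os} F =
      trans (∑-cartesianProductWith _∷_ (allFin (#outcomes o)) (assignmentsOn os) _)
        (∑-cong (allFin _) λ a → trans
          (∑-cong (assignmentsOn os) λ h → Solver.solve 3 (λ f r w →
             f Solver.:* (r Solver.:* w) Solver.:= r Solver.:* (f Solver.:* w))
             refl (F (a ∷ h)) (ρ o a) (weight h))
          (∑-*ˡ (assignmentsOn os) (ρ o a) _))

    expectation-cong : ∀ {os} {F G : All Outcome os → Carrier} → (∀ h → F h ≈ G h) →
                       expectation F ≈ expectation G
    expectation-cong {os} F≈G = ∑-cong (assignmentsOn os) (λ h → *-congʳ (F≈G h))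

    average-const : ∀ o k → ∑[ a ∈ allFin (#outcomes o) ] (ρ o a * k) ≈ k
    average-const o k = begin-equality
      ∑[ a ∈ allFin (#outcomes o) ] (ρ o a * k)  ≈⟨ ∑-cong (allFin _) (λ a → *-comm (ρ o a) k) ⟩
      ∑[ a ∈ allFin (#outcomes o) ] (k * ρ o a)  ≈⟨ ∑-*ˡ (allFin _) k (ρ o) ⟩
      k * ∑ (allFin (#outcomes o)) (ρ o)         ≈⟨ *-congˡ (ρ-normalised o) ⟩
      k * 1#                                     ≈⟨ *-identityʳ k ⟩
      k                                          ∎

    expectation-1 : ∀ os → expectation {os} (λ _ → 1#) ≈ 1#
    expectation-1 []       = trans (+-identityʳ _) (*-identityʳ 1#)
    expectation-1 (o ∷ os) = trans (expectation-∷ {o} {os} (λ _ → 1#))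
      (trans (average-const o _) (expectation-1 os))

    Ignores : Obs → ∀ {os} → (All Outcome os → Carrier) → Set _
    Ignores y {os} F = ∀ {h h′} →
      (∀ {x} (x∈ : x ∈ os) → x ≢ y → All.lookup h x∈ ≡ All.lookup h′ x∈) → F h ≈ F h′

    -- Induction on the position of `y`. At `y` itself the indicator fixes the head to `v`, and `F`
    -- may be evaluated with head `v` throughout, so `ρ y v` factors out; at any other head the
    -- claim is averaged over the head outcome.
    independence : ∀ {os y} (y∈ : y ∈ os) v (F : All Outcome os → Carrier) → Ignores y F →
      expectation (λ h → 𝟙 (All.lookup h y∈ ≟ v) * F h) ≈ ρ y v * expectation F
    independence {y ∷ os} (here ≡.refl) v F ignores = begin-equality
      expectation (λ h → 𝟙 (All.lookup h (here ≡.refl) ≟ v) * F h)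
        ≈⟨ expectation-∷ (λ h → 𝟙 (All.lookup h (here ≡.refl) ≟ v) * F h) ⟩
      ∑[ a ∈ allFin _ ] (ρ y a * expectation (λ h → 𝟙 (a ≟ v) * F (a ∷ h)))
        ≈⟨ ∑-cong (allFin _) (λ a → begin-equality
             ρ y a * expectation (λ h → 𝟙 (a ≟ v) * F (a ∷ h))
               ≈⟨ *-congˡ (∑-cong (assignmentsOn os) λ h → trans (*-congʳ
                    (*-cong (𝟙-cong (a ≟ v) (v ≟ a) ≡.sym ≡.sym) (insensitive a v h)))
                    (*-assoc _ _ _)) ⟩
             ρ y a * ∑[ h ∈ assignmentsOn os ] (𝟙 (v ≟ a) * (F (v ∷ h) * weight h))
               ≈⟨ *-congˡ (∑-*ˡ (assignmentsOn os) (𝟙 (v ≟ a)) _) ⟩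
             ρ y a * (𝟙 (v ≟ a) * expectation (λ h → F (v ∷ h)))
               ≈⟨ Solver.solve 3 (λ r i x →
                    r Solver.:* (i Solver.:* x) Solver.:= i Solver.:* (r Solver.:* x))
                    refl (ρ y a) (𝟙 (v ≟ a)) _ ⟩
             𝟙 (v ≟ a) * (ρ y a * expectation (λ h → F (v ∷ h)))
               ∎) ⟩
      ∑[ a ∈ allFin _ ] (𝟙 (v ≟ a) * (ρ y a * expectation (λ h → F (v ∷ h))))
        ≈⟨ ∑-sift _≟_ (Uniqueₚ.allFin⁺ _) (∈-allFin v) _ ⟩
      ρ y v * expectation (λ h → F (v ∷ h))
        -- `F (v ∷ h)` is constant in `a`, so averaging it over `a` changes nothing. Replacing `v`
        -- by `a` under the average then restores the full expectation.
        ≈⟨ *-congˡ (average-const y (expectation (λ h → F (v ∷ h)))) ⟨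
      ρ y v * ∑[ a ∈ allFin _ ] (ρ y a * expectation (λ h → F (v ∷ h)))
        ≈⟨ *-congˡ (∑-cong (allFin _) λ a → *-congˡ (expectation-cong {os} (insensitive v a))) ⟩
      ρ y v * ∑[ a ∈ allFin _ ] (ρ y a * expectation (λ h → F (a ∷ h)))
        ≈⟨ *-congˡ (expectation-∷ F) ⟨
      ρ y v * expectation F
        ∎
      where
      insensitive : ∀ a b h → F (a ∷ h) ≈ F (b ∷ h)
      insensitive a b h = ignores λ where
        (here ≡.refl) x≢x → contradiction ≡.refl x≢x
        (there _)     _   → ≡.refl
    independence {o ∷ os} {y} (there y∈) v F ignores = begin-equality
      expectation (λ h → 𝟙 (All.lookup h (there y∈) ≟ v) * F h)
        ≈⟨ expectation-∷ (λ h → 𝟙 (All.lookup h (there y∈) ≟ v) * F h) ⟩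
      ∑[ a ∈ allFin _ ] (ρ o a * expectation (λ h → 𝟙 (All.lookup h y∈ ≟ v) * F (a ∷ h)))
        ≈⟨ ∑-cong (allFin _) (λ a → *-congˡ (independence y∈ v (λ h → F (a ∷ h))
             λ agree → ignores λ where
               (here ≡.refl) _   → ≡.refl
               (there x∈)    x≢y → agree x∈ x≢y)) ⟩
      ∑[ a ∈ allFin _ ] (ρ o a * (ρ y v * expectation (λ h → F (a ∷ h))))
        ≈⟨ ∑-cong (allFin _) (λ a → Solver.solve 3 (λ r s x →
             r Solver.:* (s Solver.:* x) Solver.:= s Solver.:* (r Solver.:* x))
             refl (ρ o a) (ρ y v) _) ⟩
      ∑[ a ∈ allFin _ ] (ρ y v * (ρ o a * expectation (λ h → F (a ∷ h))))
        ≈⟨ ∑-*ˡ (allFin (#outcomes o)) (ρ y v) _ ⟩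
      ρ y v * ∑[ a ∈ allFin _ ] (ρ o a * expectation (λ h → F (a ∷ h)))
        ≈⟨ *-congˡ (expectation-∷ F) ⟨
      ρ y v * expectation F
        ∎

    values : ∀ {os n} (x : Fin n → Obs) → (∀ j → x j ∈ os) → All Outcome os → Tuple (#outcomes ∘ x)
    values x x∈ h = fromFunction (λ j → All.lookup h (x∈ j))

    -- Peels off one observable at a time. Injectivity of `x` makes the event on the later
    -- observables ignore the first one, which is what `independence` asks for.
    product-marginal : ∀ {os n} (x : Fin n → Obs) → Injective _≡_ _≡_ x → (x∈ : ∀ j → x j ∈ os)
      (u : Tuple (#outcomes ∘ x)) →
      expectation (λ h → 𝟙 (values x x∈ h ≟ₜ u))
        ≈ productOver (allFin n) (λ j → ρ (x j) (lookup {d = #outcomes ∘ x} u j))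
    product-marginal {os} {zero} x x-inj x∈ tt =
      trans (expectation-cong {os} λ h → 𝟙-yes (_≟ₜ_ {d = #outcomes ∘ x} tt tt) ≡.refl)
            (expectation-1 os)
    product-marginal {os} {suc n} x x-inj x∈ (a , u) = begin-equality
      expectation (λ h → 𝟙 (_≟ₜ_ {d = #outcomes ∘ x} (values x x∈ h) (a , u)))
        ≈⟨ expectation-cong {os} (λ h → trans
             (𝟙-cong (_≟ₜ_ {d = #outcomes ∘ x} (values x x∈ h) (a , u))
                     (All.lookup h (x∈ zero) ≟ a ×-dec tail h ≟ₜ u)
               ,-injective λ { (≡.refl , ≡.refl) → ≡.refl })
             (𝟙-× (All.lookup h (x∈ zero) ≟ a) (tail h ≟ₜ u))) ⟩
      expectation (λ h → 𝟙 (All.lookup h (x∈ zero) ≟ a) * 𝟙 (tail h ≟ₜ u))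
        ≈⟨ independence (x∈ zero) a (λ h → 𝟙 (tail h ≟ₜ u)) (λ agree → reflexive
             (≡.cong (λ t → 𝟙 (t ≟ₜ u)) (fromFunction-cong λ j → agree (x∈ (suc j)) λ eq →
               contradiction (x-inj eq) λ ()))) ⟩
      ρ (x zero) a * expectation (λ h → 𝟙 (tail h ≟ₜ u))
        ≈⟨ *-congˡ (product-marginal (x ∘ suc) (suc-injective ∘ x-inj) (x∈ ∘ suc) u) ⟩
      ρ (x zero) a * productOver (allFin n) (λ j → ρ (x (suc j)) (lookup u j))
        -- `allFin` is a tabulation, so the tail of `allFin (suc n)` is not literally an image of
        -- `allFin n`; both factor lists are rewritten as one tabulation.
        ≡⟨ ≡.cong (λ ks → ρ (x zero) a * foldr _*_ 1# ks) (≡.trans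
             (map-tabulate (λ j → j) (λ j → ρ (x (suc j)) (lookup u j)))
             (≡.sym (map-tabulate suc (λ j → ρ (x j) (lookup {d = #outcomes ∘ x} (a , u) j))))) ⟩
      productOver (allFin (suc n)) (λ j → ρ (x j) (lookup {d = #outcomes ∘ x} (a , u) j))
        ∎
      where
      tail : All Outcome os → Tuple (#outcomes ∘ x ∘ suc)
      tail = values (x ∘ suc) (x∈ ∘ suc)

-- Link and occurrence contexts of a lift.

module LiftProperties {c ℓ₁ ℓ₂} (𝔽 : OrderedField c ℓ₁ ℓ₂) {𝓢 : Signature} {𝐁 : Structure 𝓢}
                      (𝐗 : Instance 𝓢) (𝒯 : Tables 𝔽 𝐁) where
  open OrderedField 𝔽
  open OrderedFieldProperties 𝔽
  open Signature 𝓢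
  open Structure 𝐁
  open Instance 𝐗
  open Tables 𝒯
  open EmpiricalModel (occurrenceLift 𝔽 𝐗 𝒯)
  open EmpiricalModelProperties (occurrenceLift 𝔽 𝐗 𝒯)

  link-table : ∀ k j a b → table (link k j) (a , b , tt) ≈ 𝟙 (a ≟ b) * π (sortAt k j) a
  link-table k j a b = if-𝟙 (a ≟ b) (π (sortAt k j) a)

  -- A single weight is at most the table entry at its own restriction, and link tables are zero off
  -- the diagonal.
  offDiagonal-vanishes : ∀ {b} → IsFeasible 𝔽 (occurrenceLift 𝔽 𝐗 𝒯) b → ∀ k j g →
    g at central (sortAt k j) (scope k j) ≢ g at fresh k j → b g ≈ 0#
  offDiagonal-vanishes feas k j g x≢y = ≤-antisym
    (≤-respʳ (trans (link-table k j x y) (trans (*-congʳ (𝟙-no (x ≟ y) x≢y)) (zeroˡ _)))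
             (weight≤table feas (link k j) g))
    (IsFeasible.nonNegative feas g)
    where
    x = g at central (sortAt k j) (scope k j)
    y = g at fresh k j

  freshValues : ((o : Observable 𝐗) → Outcome o) → ∀ k → Args (symbol k)
  freshValues φ k = fromFunction (λ j → φ (fresh k j))

  tables-nonNegative : IsBalanced 𝔽 𝒯 → ∀ C u → 0# ≤ table C u
  tables-nonNegative balanced (occurrence k) u =
    IsDistribution.nonNegative (IsBalanced.μ-distribution balanced (symbol k)) u
  tables-nonNegative balanced (link k j) (a , b , tt) = ≤-respʳ (sym (link-table k j a b))
    (*-nonNegative (𝟙-nonNegative (a ≟ b))
                   (proj₁ (IsBalanced.π-fullSupport balanced (sortAt k j) a)))

  module _ {I : Set} (is : List I) (w : I → Carrier) (φ : I → (o : Observable 𝐗) → Outcome o)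
           (k : Constraint) (j : Position k)
           (diagonal : ∀ i → φ i (central (sortAt k j) (scope k j)) ≢ φ i (fresh k j) → w i ≈ 0#)
           where

    -- For a weight carried by the diagonal, a link event `(a , b)` is empty unless `a ≡ b`, and
    -- then it is the event that the fresh observable takes the value `a`. Only that one-variable
    -- marginal has to be bounded.
    link-bound : (∀ a → ∑[ i ∈ is ] (𝟙 (φ i (fresh k j) ≟ a) * w i) ≤ π (sortAt k j) a) →
      ∀ u → ∑[ i ∈ is ] (𝟙 (marginal? (φ i) (link k j) u) * w i) ≤ table (link k j) u
    link-bound bound (a , b , tt) = begin
      ∑[ i ∈ is ] (𝟙 (marginal? (φ i) (link k j) (a , b , tt)) * w i)
        ≈⟨ ∑-cong is term ⟩
      ∑[ i ∈ is ] (𝟙 (a ≟ b) * (𝟙 (φ i (fresh k j) ≟ a) * w i))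
        ≈⟨ ∑-*ˡ is (𝟙 (a ≟ b)) _ ⟩
      𝟙 (a ≟ b) * ∑[ i ∈ is ] (𝟙 (φ i (fresh k j) ≟ a) * w i)
        ≤⟨ *-monoˡ-≤ (𝟙-nonNegative (a ≟ b)) (bound a) ⟩
      𝟙 (a ≟ b) * π (sortAt k j) a
        ≈⟨ link-table k j a b ⟨
      table (link k j) (a , b , tt)
        ∎
      where
      term : ∀ i → 𝟙 (marginal? (φ i) (link k j) (a , b , tt)) * w i
                   ≈ 𝟙 (a ≟ b) * (𝟙 (φ i (fresh k j) ≟ a) * w i)
      term i with φ i (central (sortAt k j) (scope k j)) ≟ φ i (fresh k j)
      ... | no x≢y = trans (*-congˡ w≈0) (trans (zeroʳ _) (sym
                       (trans (*-congˡ (trans (*-congˡ w≈0) (zeroʳ _))) (zeroʳ _))))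
        where w≈0 = diagonal i x≢y
      ... | yes x≡y = trans (*-congʳ (trans
        (𝟙-cong (marginal? (φ i) (link k j) (a , b , tt)) (a ≟ b ×-dec φ i (fresh k j) ≟ a)
          (λ { ≡.refl → x≡y , ≡.sym x≡y })
          (λ { (≡.refl , ≡.refl) → ≡.cong (λ v → v , φ i (fresh k j) , tt) x≡y }))
        (𝟙-× (a ≟ b) (φ i (fresh k j) ≟ a)))) (*-assoc _ _ _)

    -- The event that position `j` has value `a` is the disjoint union of the occurrence events of
    -- the tuples `t` with `lookup t j ≡ a`. Summing their bounds gives a marginal of `μ`, which
    -- balance compares with `π`.
    occurrence-bound⇒link-bound :
      (∀ a → ∑[ t ∈ allTuples (#dom ∘ sort (symbol k)) ] (𝟙 (lookup t j ≟ a) * μ (symbol k) t)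
               ≤ π (sortAt k j) a) →
      (∀ t → ∑[ i ∈ is ] (𝟙 (freshValues (φ i) k ≟ₜ t) * w i) ≤ μ (symbol k) t) →
      ∀ u → ∑[ i ∈ is ] (𝟙 (marginal? (φ i) (link k j) u) * w i) ≤ table (link k j) u
    occurrence-bound⇒link-bound μ-marginal bound = link-bound λ a → begin
      ∑[ i ∈ is ] (𝟙 (φ i (fresh k j) ≟ a) * w i)
        ≈⟨ ∑-cong is (λ i → *-congʳ (reflexive (≡.cong (λ v → 𝟙 (v ≟ a))
             (≡.sym (lookup-fromFunction (λ j → φ i (fresh k j)) j))))) ⟩
      ∑[ i ∈ is ] (𝟙 (lookup (freshValues (φ i) k) j ≟ a) * w i)
        ≈⟨ ∑-cong is (λ i → ∑-sift _≟ₜ_ (Listing.unique tuples)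
             (Listing.complete tuples (freshValues (φ i) k))
             (λ t → 𝟙 (lookup t j ≟ a) * w i)) ⟨
      ∑[ i ∈ is ] ∑[ t ∈ ts ] (𝟙 (freshValues (φ i) k ≟ₜ t) * (𝟙 (lookup t j ≟ a) * w i))
        ≈⟨ ∑-swap is ts _ ⟩
      ∑[ t ∈ ts ] ∑[ i ∈ is ] (𝟙 (freshValues (φ i) k ≟ₜ t) * (𝟙 (lookup t j ≟ a) * w i))
        ≈⟨ ∑-cong ts (λ t → trans
             (∑-cong is λ i → Solver.solve 3 (λ p q r →
               p Solver.:* (q Solver.:* r) Solver.:= q Solver.:* (p Solver.:* r)) refl
               (𝟙 (freshValues (φ i) k ≟ₜ t)) (𝟙 (lookup t j ≟ a)) (w i))
             (∑-*ˡ is (𝟙 (lookup t j ≟ a)) _)) ⟩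
      ∑[ t ∈ ts ] (𝟙 (lookup t j ≟ a) * ∑[ i ∈ is ] (𝟙 (freshValues (φ i) k ≟ₜ t) * w i))
        ≤⟨ ∑-mono ts (λ t → *-monoˡ-≤ (𝟙-nonNegative (lookup t j ≟ a)) (bound t)) ⟩
      ∑[ t ∈ ts ] (𝟙 (lookup t j ≟ a) * μ (symbol k) t)
        ≤⟨ μ-marginal a ⟩
      π (sortAt k j) a
        ∎
      where
      tuples : Listing (Args (symbol k))
      tuples = tupleListing (#dom ∘ sort (symbol k))
      ts = Listing.elements tuples

-- The product measure on a lift.

module _ {c ℓ₁ ℓ₂} (𝔽 : OrderedField c ℓ₁ ℓ₂) {𝓢 : Signature} {𝐁 : Structure 𝓢}
         (𝒯 : Tables 𝔽 𝐁) where
  open OrderedField 𝔽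
  open Signature 𝓢
  open Tables 𝒯

  -- The `r = z` layer of the gated tables without its factor `ϑ * ½`. With full-support `π` these
  -- tables are positive on all tuples, inside the relation or not.
  productTables : Tables 𝔽 𝐁
  productTables = record
    { π = π
    ; μ = λ R t → productOver (allFin (arity R)) (λ j → π (sort R j) (lookup t j))
    }

-- Not definitional: assignmentsOn recurses on the list of observables with the whole model,
-- tables included, as a parameter.
globalAssignments-independent : ∀ {c ℓ₁ ℓ₂} (𝔽 : OrderedField c ℓ₁ ℓ₂) {𝓢 : Signature}
  {𝐁 : Structure 𝓢} (𝐗 : Instance 𝓢) (𝒯 𝒯′ : Tables 𝔽 𝐁) →
  EmpiricalModel.globalAssignments (occurrenceLift 𝔽 𝐗 𝒯) ≡
  EmpiricalModel.globalAssignments (occurrenceLift 𝔽 𝐗 𝒯′)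
globalAssignments-independent 𝔽 {𝐁 = 𝐁} 𝐗 𝒯 𝒯′ = go _
  where
  module E  = EmpiricalModel (occurrenceLift 𝔽 𝐗 𝒯)
  module E′ = EmpiricalModel (occurrenceLift 𝔽 𝐗 𝒯′)
  go : ∀ os → E.assignmentsOn os ≡ E′.assignmentsOn os
  go []       = ≡.refl
  go (o ∷ os) = ≡.cong (cartesianProductWith _∷_ (allFin (E.#outcomes o))) (go os)

module ProductLift {c ℓ₁ ℓ₂} (𝔽 : OrderedField c ℓ₁ ℓ₂) {𝓢 : Signature} {𝐁 : Structure 𝓢}
                   (𝐗 : Instance 𝓢) (simple : IsSimple 𝐗) (𝒯 : Tables 𝔽 𝐁)
                   (𝒯-balanced : IsBalanced 𝔽 𝒯) where
  open OrderedField 𝔽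
  open OrderedFieldProperties 𝔽
  open Signature 𝓢
  open Structure 𝐁
  open Instance 𝐗
  open Tables 𝒯
  open IsBalanced 𝒯-balanced

  e : EmpiricalModel 𝔽
  e = occurrenceLift 𝔽 𝐗 (productTables 𝔽 𝒯)

  open EmpiricalModel e
  open EmpiricalModelProperties e
  open LiftProperties 𝔽 𝐗 (productTables 𝔽 𝒯) using (link-bound; freshValues)

  ρ : (o : Observable 𝐗) → Outcome o → Carrier
  ρ (central s x) = π s
  ρ (fresh k j)   = π (sortAt k j)

  ρ-normalised : ∀ o → ∑ (allFin (#outcomes o)) (ρ o) ≈ 1#
  ρ-normalised (central s x) = IsDistribution.normalised (π-distribution s)
  ρ-normalised (fresh k j)   = IsDistribution.normalised (π-distribution (sortAt k j))

  ρ-nonNegative : ∀ o a → 0# ≤ ρ o a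
  ρ-nonNegative (central s x) a = proj₁ (π-fullSupport s a)
  ρ-nonNegative (fresh k j)   a = proj₁ (π-fullSupport (sortAt k j) a)

  open ProductMeasure ρ ρ-normalised

  centrals : List (Observable 𝐗)
  centrals = elementsΣ central

  central∈ : ∀ s x → central s x ∈ centrals
  central∈ = ∈-elementsΣ⁺ central

  -- Only the central observables are drawn independently; each fresh one copies its central one,
  -- which puts the measure on the diagonal of every link.
  diagonal : All Outcome centrals → (o : Observable 𝐗) → Outcome o
  diagonal h (central s x) = All.lookup h (central∈ s x)
  diagonal h (fresh k j)   = All.lookup h (central∈ (sortAt k j) (scope k j))

  open Pushforward (assignmentsOn centrals) weight diagonal public
    renaming (pushforward to product)

  central-injective : ∀ {s s′ x x′} → central {𝐗 = 𝐗} s x ≡ central s′ x′ →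
                      _≡_ {A = Σ Sort Var} (s , x) (s′ , x′)
  central-injective ≡.refl = ≡.refl

  -- The fresh observables of one constraint copy its scope. Since the scope has pairwise distinct
  -- variables, the copies are independent, and their joint law is exactly the product table.
  product-occurrence : ∀ k t →
    ∑[ h ∈ assignmentsOn centrals ] (𝟙 (freshValues (diagonal h) k ≟ₜ t) * weight h)
      ≈ Tables.μ (productTables 𝔽 𝒯) (symbol k) t
  product-occurrence k t = product-marginal
    (λ j → central (sortAt k j) (scope k j))
    (IsSimple.distinct simple k ∘ central-injective)
    (λ j → central∈ (sortAt k j) (scope k j)) t

  product-variable : ∀ k j a →
    ∑[ h ∈ assignmentsOn centrals ] (𝟙 (diagonal h (fresh k j) ≟ a) * weight h) ≈ π (sortAt k j) a
  product-variable k j a = begin-equality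
    expectation (λ h → 𝟙 (diagonal h (fresh k j) ≟ a))
      ≈⟨ expectation-cong {centrals} (λ h → *-identityʳ _) ⟨
    expectation (λ h → 𝟙 (diagonal h (fresh k j) ≟ a) * 1#)
      ≈⟨ independence (central∈ (sortAt k j) (scope k j)) a (λ _ → 1#) (λ _ → refl) ⟩
    π (sortAt k j) a * expectation {centrals} (λ _ → 1#)
      ≈⟨ *-congˡ (expectation-1 centrals) ⟩
    π (sortAt k j) a * 1#
      ≈⟨ *-identityʳ _ ⟩
    π (sortAt k j) a
      ∎

  product-feasible : IsFeasible 𝔽 e product
  product-feasible = pushforward-feasible (weight-nonNegative ρ-nonNegative) λ where
    (occurrence k) u → ≤-reflexive (product-occurrence k u)
    (link k j)     u → link-bound (assignmentsOn centrals) weight diagonal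
      k j (λ h x≢x → contradiction ≡.refl x≢x) (λ a → ≤-reflexive (product-variable k j a)) u

  ∑-weight : ∑ (assignmentsOn centrals) weight ≈ 1#
  ∑-weight = trans (∑-cong (assignmentsOn centrals) λ h → sym (*-identityˡ (weight h)))
                   (expectation-1 centrals)

  product-total : ∑ globalAssignments product ≈ 1#
  product-total = trans total-pushforward ∑-weight

  -- Read off from the measure: each entry of the table is a mass of `product`, and the masses in
  -- one context add up to its total `1#`.
  productTable-normalised : ∀ k →
    ∑ (allTuples (#dom ∘ sort (symbol k))) (Tables.μ (productTables 𝔽 𝒯) (symbol k)) ≈ 1#
  productTable-normalised k = begin-equality
    ∑ ts (Tables.μ (productTables 𝔽 𝒯) (symbol k))
      ≈⟨ ∑-cong ts (λ t → trans (mass-pushforward (occurrence k) t) (product-occurrence k t)) ⟨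
    ∑[ t ∈ ts ] mass product (occurrence k) t
      ≈⟨ ∑-mass product (occurrence k) ⟩
    ∑ globalAssignments product
      ≈⟨ product-total ⟩
    1#
      ∎
    where
    ts = allTuples (#dom ∘ sort (symbol k))

-- Arithmetic of the gate.

module GatedLift {c ℓ₁ ℓ₂} (𝔽 : OrderedField c ℓ₁ ℓ₂) {𝓢 : Signature} {𝐁 : Structure 𝓢}
                 (𝐗 : Instance 𝓢) (𝒯 : Tables 𝔽 𝐁)
                 (ϑ : OrderedField.Carrier 𝔽)
                 (0<ϑ : OrderedField._<_ 𝔽 (OrderedField.0# 𝔽) ϑ)
                 (ϑ<1 : OrderedField._<_ 𝔽 ϑ (OrderedField.1# 𝔽)) where
  open OrderedField 𝔽
  open OrderedFieldProperties 𝔽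
  open Signature 𝓢
  open Structure 𝐁
  open Instance 𝐗
  open Tables 𝒯
  open Tables (productTables 𝔽 𝒯) using () renaming (μ to Ππ)

  ψ : Carrier
  ψ = 1# - ϑ

  0≤ϑ : 0# ≤ ϑ
  0≤ϑ = proj₁ 0<ϑ

  0<ψ : 0# < ψ
  0<ψ = x≤y⇒0≤y-x (proj₁ ϑ<1) , λ 0≈ψ → proj₂ ϑ<1 (begin-equality
    ϑ       ≈⟨ +-identityˡ ϑ ⟨
    0# + ϑ  ≈⟨ +-congʳ 0≈ψ ⟩
    ψ + ϑ   ≈⟨ x-y+y≈x 1# ϑ ⟩
    1#      ∎)

  0≤ψ : 0# ≤ ψ
  0≤ψ = proj₁ 0<ψ

  ϑx+ψx≈x : ∀ x → ϑ * x + ψ * x ≈ x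
  ϑx+ψx≈x x = begin-equality
    ϑ * x + ψ * x  ≈⟨ distribʳ x ϑ ψ ⟨
    (ϑ + ψ) * x    ≈⟨ *-congʳ (trans (+-comm ϑ ψ) (x-y+y≈x 1# ϑ)) ⟩
    1# * x         ≈⟨ *-identityˡ x ⟩
    x              ∎

  mixture-mono : ∀ {x y u v} → x ≤ u → y ≤ v → ϑ * x + ψ * y ≤ ϑ * u + ψ * v
  mixture-mono x≤u y≤v = +-mono-≤ (*-monoˡ-≤ 0≤ϑ x≤u) (*-monoˡ-≤ 0≤ψ y≤v)

  -- Both the gated tables, with `x` and `y` the entries of the product table and of `μ`, and the
  -- glued weights, with `x` and `y` values of `b₀` and `b₁`, have this shape. Being linear and
  -- monotone in `x` and `y`, it passes the bounds on the two layers to the gated model.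
  gated : Carrier → Carrier → Fin 2 → Fin 2 → Carrier
  gated x y r z = ϑ * (𝟙 (z ≟ r) * (½ * x)) + ψ * (𝟙 (z ≟ opposite r) * (½ * y))

  gated-mono : ∀ {x y u v} → x ≤ u → y ≤ v → ∀ r z → gated x y r z ≤ gated u v r z
  gated-mono x≤u y≤v r z = mixture-mono
    (*-monoˡ-≤ (𝟙-nonNegative (z ≟ r)) (*-monoˡ-≤ 0≤½ x≤u))
    (*-monoˡ-≤ (𝟙-nonNegative (z ≟ opposite r)) (*-monoˡ-≤ 0≤½ y≤v))

  gated-nonNegative : ∀ {x y} → 0# ≤ x → 0# ≤ y → ∀ r z → 0# ≤ gated x y r z
  gated-nonNegative 0≤x 0≤y r z = +-nonNegative
    (*-nonNegative 0≤ϑ (*-nonNegative (𝟙-nonNegative (z ≟ r)) (*-nonNegative 0≤½ 0≤x)))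
    (*-nonNegative 0≤ψ (*-nonNegative (𝟙-nonNegative (z ≟ opposite r)) (*-nonNegative 0≤½ 0≤y)))

  module _ (x y : Carrier) where

    private
      open Solver
      same opposed : ∀ {n} (t s h x y : Polynomial n) → Polynomial n
      same    t s h x y = t :* (con 1 :* (h :* x)) :+ s :* (con 0 :* (h :* y))
      opposed t s h x y = t :* (con 0 :* (h :* x)) :+ s :* (con 1 :* (h :* y))

      same+opposed : gated x y zero zero + (gated x y zero (suc zero) + 0#) ≈ ½ * (ϑ * x + ψ * y)
      same+opposed = solve 5 (λ t s h x y → same t s h x y :+ (opposed t s h x y :+ con 0)
        := h :* (t :* x :+ s :* y)) refl ϑ ψ ½ x y

      opposed+same : gated x y zero (suc zero) + (gated x y zero zero + 0#) ≈ ½ * (ϑ * x + ψ * y)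
      opposed+same = solve 5 (λ t s h x y → opposed t s h x y :+ (same t s h x y :+ con 0)
        := h :* (t :* x :+ s :* y)) refl ϑ ψ ½ x y

      double : ∀ k → ½ * k + ½ * k ≈ k
      double k = trans (sym (distribʳ k ½ ½)) (trans (*-congʳ ½+½≈1) (*-identityˡ k))

    -- For either `r`, one value of `z` equals `r` and the other is opposite, so `x` and `y` each
    -- contribute once. This is why the gate marginal is uniform.
    ∑-gated-z : ∀ r → ∑[ z ∈ allFin 2 ] gated x y r z ≈ ½ * (ϑ * x + ψ * y)
    ∑-gated-z zero       = same+opposed
    ∑-gated-z (suc zero) = opposed+same

    ∑-gated-r : ∀ z → ∑[ r ∈ allFin 2 ] gated x y r z ≈ ½ * (ϑ * x + ψ * y)
    ∑-gated-r zero       = same+opposed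
    ∑-gated-r (suc zero) = opposed+same

    ∑-gated : ∑[ r ∈ allFin 2 ] ∑[ z ∈ allFin 2 ] gated x y r z ≈ ϑ * x + ψ * y
    ∑-gated = begin-equality
      ∑[ r ∈ allFin 2 ] ∑[ z ∈ allFin 2 ] gated x y r z  ≈⟨ ∑-cong (allFin 2) ∑-gated-z ⟩
      ½ * k + (½ * k + 0#)                               ≈⟨ +-congˡ (+-identityʳ _) ⟩
      ½ * k + ½ * k                                      ≈⟨ double k ⟩
      k                                                  ∎
      where k = ϑ * x + ψ * y

    ∑-gated-same : ∑[ r ∈ allFin 2 ] gated x y r r ≈ ϑ * x
    ∑-gated-same = trans
      (solve 5 (λ t s h x y → same t s h x y :+ (same t s h x y :+ con 0)
        := h :* (t :* x) :+ h :* (t :* x)) refl ϑ ψ ½ x y)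
      (double (ϑ * x))

    ∑-gated-opposite : ∑[ r ∈ allFin 2 ] gated x y r (opposite r) ≈ ψ * y
    ∑-gated-opposite = trans
      (solve 5 (λ t s h x y → opposed t s h x y :+ (opposed t s h x y :+ con 0)
        := h :* (s :* y) :+ h :* (s :* y)) refl ϑ ψ ½ x y)
      (double (ψ * y))

  same-or-opposite : ∀ (r z : Fin 2) → 𝟙 (z ≟ r) + 𝟙 (z ≟ opposite r) ≈ 1#
  same-or-opposite zero       zero       = +-identityʳ 1#
  same-or-opposite zero       (suc zero) = +-identityˡ 1#
  same-or-opposite (suc zero) zero       = +-identityˡ 1#
  same-or-opposite (suc zero) (suc zero) = +-identityʳ 1#

  X̂ : Instance (gateSignature 𝓢)
  X̂ = gateInstance 𝐗

  e ê : EmpiricalModel 𝔽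
  e = occurrenceLift 𝔽 𝐗 𝒯
  ê = occurrenceLift 𝔽 X̂ (gateTables 𝔽 𝒯 ϑ)

  module E where
    open EmpiricalModel e public
    open EmpiricalModelProperties e public
    open LiftProperties 𝔽 𝐗 𝒯 public

  module Ê where
    open EmpiricalModel ê public
    open EmpiricalModelProperties ê public
    open LiftProperties 𝔽 X̂ (gateTables 𝔽 𝒯 ϑ) public

  occurrence-table : ∀ k r z t → Ê.table (occurrence k) (r , z , t) ≈
                                 gated (Ππ (symbol k) t) (μ (symbol k) t) r z
  occurrence-table k r z t = +-cong (*-congˡ (if-𝟙 (z ≟ r) _)) (*-congˡ (if-𝟙 (z ≟ opposite r) _))

  extend : Fin 2 → Fin 2 → ((o : Observable 𝐗) → E.Outcome o) → (o : Observable X̂) → Ê.Outcome o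
  extend r z f (central zero zero)       = r
  extend r z f (central zero (suc zero)) = z
  extend r z f (central (suc s) x)       = f (central s x)
  extend r z f (fresh k zero)            = r
  extend r z f (fresh k (suc zero))      = z
  extend r z f (fresh k (suc (suc j)))   = f (fresh k j)

  forget : ((o : Observable X̂) → Ê.Outcome o) → (o : Observable 𝐗) → E.Outcome o
  forget f (central s x) = f (central (suc s) x)
  forget f (fresh k j)   = f (fresh k (suc (suc j)))

  -- Lower bound: gluing weights of the two layers.

  module Gluing {b₀ b₁ : E.GlobalAssignment → Carrier}
                (b₀-feasible : IsFeasible 𝔽 (occurrenceLift 𝔽 𝐗 (productTables 𝔽 𝒯)) b₀)
                (b₁-feasible : IsFeasible 𝔽 e b₁)
                (∑b₀≤1 : ∑ E.globalAssignments b₀ ≤ 1#)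
                (∑b₁≤1 : ∑ E.globalAssignments b₁ ≤ 1#) where

    private
      module P = EmpiricalModelProperties (occurrenceLift 𝔽 𝐗 (productTables 𝔽 𝒯))

    b₀-bound : ∀ C u → ∑[ g ∈ E.globalAssignments ] (𝟙 (E.restrict g C ≟ₜ u) * b₀ g)
                         ≤ liftTable 𝔽 𝐗 (productTables 𝔽 𝒯) C u
    b₀-bound C u = ≡.subst
      (λ gs → ∑[ g ∈ gs ] (𝟙 (E.restrict g C ≟ₜ u) * b₀ g) ≤ liftTable 𝔽 𝐗 (productTables 𝔽 𝒯) C u)
      (globalAssignments-independent 𝔽 𝐗 (productTables 𝔽 𝒯) 𝒯)
      (P.mass≤table b₀-feasible C u)

    private
      gs : List E.GlobalAssignment
      gs = E.globalAssignments

    Index : Set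
    Index = Fin 2 × Fin 2 × E.GlobalAssignment

    indices : List Index
    indices = cartesianProduct (allFin 2) (cartesianProduct (allFin 2) gs)

    -- For normalised weights: `r` is a fair coin, `z` equals `r` with probability `ϑ`, and the rest
    -- is drawn from `b₀` if `r = z` and from `b₁` otherwise.
    w : Index → Carrier
    w (r , z , g) = gated (b₀ g) (b₁ g) r z

    w-nonNegative : ∀ i → 0# ≤ w i
    w-nonNegative (r , z , g) = gated-nonNegative (IsFeasible.nonNegative b₀-feasible g)
                                                  (IsFeasible.nonNegative b₁-feasible g) r z

    φ : Index → (o : Observable X̂) → Ê.Outcome o
    φ (r , z , g) = extend r z (g E.at_)

    ∑-indices : (f : Index → Carrier) → ∑ indices f ≈
      ∑[ r ∈ allFin 2 ] ∑[ z ∈ allFin 2 ] ∑[ g ∈ gs ] f (r , z , g)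
    ∑-indices f = trans
      (∑-cartesianProductWith _,_ (allFin 2) (cartesianProduct (allFin 2) gs) f)
      (∑-cong (allFin 2) λ r → ∑-cartesianProductWith _,_ (allFin 2) gs (λ i → f (r , i)))

    ∑-slice : (F : E.GlobalAssignment → Carrier) (r z : Fin 2) → ∑[ g ∈ gs ] (F g * w (r , z , g)) ≈
      gated (∑[ g ∈ gs ] (F g * b₀ g)) (∑[ g ∈ gs ] (F g * b₁ g)) r z
    ∑-slice F r z = begin-equality
      ∑[ g ∈ gs ] (F g * w (r , z , g))
        ≈⟨ ∑-cong gs (λ g → Solver.solve 8 (λ t s i j h f x y →
             let open Solver in
             f :* (t :* (i :* (h :* x)) :+ s :* (j :* (h :* y)))
             := t :* (i :* h) :* (f :* x) :+ s :* (j :* h) :* (f :* y))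
             refl ϑ ψ i j ½ (F g) (b₀ g) (b₁ g)) ⟩
      ∑[ g ∈ gs ] (ϑ * (i * ½) * (F g * b₀ g) + ψ * (j * ½) * (F g * b₁ g))
        ≈⟨ ∑-+ gs _ _ ⟩
      ∑[ g ∈ gs ] (ϑ * (i * ½) * (F g * b₀ g)) + ∑[ g ∈ gs ] (ψ * (j * ½) * (F g * b₁ g))
        ≈⟨ +-cong (∑-*ˡ gs (ϑ * (i * ½)) _) (∑-*ˡ gs (ψ * (j * ½)) _) ⟩
      ϑ * (i * ½) * x + ψ * (j * ½) * y
        ≈⟨ Solver.solve 7 (λ t s i j h x y →
             let open Solver in
             t :* (i :* h) :* x :+ s :* (j :* h) :* y
             := t :* (i :* (h :* x)) :+ s :* (j :* (h :* y)))
             refl ϑ ψ i j ½ x y ⟩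
      gated x y r z
        ∎
      where
      i = 𝟙 (z ≟ r)
      j = 𝟙 (z ≟ opposite r)
      x = ∑[ g ∈ gs ] (F g * b₀ g)
      y = ∑[ g ∈ gs ] (F g * b₁ g)

    ∑-slice-1 : ∀ r z → ∑[ g ∈ gs ] w (r , z , g) ≈
                        gated (∑ gs b₀) (∑ gs b₁) r z
    ∑-slice-1 r z = begin-equality
      ∑[ g ∈ gs ] w (r , z , g)         ≈⟨ ∑-cong gs (λ g → *-identityˡ (w (r , z , g))) ⟨
      ∑[ g ∈ gs ] (1# * w (r , z , g))  ≈⟨ ∑-slice (λ _ → 1#) r z ⟩
      gated (∑[ g ∈ gs ] (1# * b₀ g)) (∑[ g ∈ gs ] (1# * b₁ g)) r z
        ≈⟨ +-cong (*-congˡ (*-congˡ (*-congˡ (∑-cong gs λ g → *-identityˡ (b₀ g)))))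
                  (*-congˡ (*-congˡ (*-congˡ (∑-cong gs λ g → *-identityˡ (b₁ g))))) ⟩
      gated (∑ gs b₀) (∑ gs b₁) r z     ∎

    ∑-unconstrained : (F : E.GlobalAssignment → Carrier) →
      ∑[ i ∈ indices ] (F (proj₂ (proj₂ i)) * w i) ≈
      ϑ * ∑[ g ∈ gs ] (F g * b₀ g) + ψ * ∑[ g ∈ gs ] (F g * b₁ g)
    ∑-unconstrained F = begin-equality
      ∑[ i ∈ indices ] (F (proj₂ (proj₂ i)) * w i)
        ≈⟨ ∑-indices _ ⟩
      ∑[ r ∈ allFin 2 ] ∑[ z ∈ allFin 2 ] ∑[ g ∈ gs ] (F g * w (r , z , g))
        ≈⟨ ∑-cong (allFin 2) (λ r → ∑-cong (allFin 2) (∑-slice F r)) ⟩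
      ∑[ r ∈ allFin 2 ] ∑[ z ∈ allFin 2 ]
        gated (∑[ g ∈ gs ] (F g * b₀ g)) (∑[ g ∈ gs ] (F g * b₁ g)) r z
        ≈⟨ ∑-gated (∑[ g ∈ gs ] (F g * b₀ g)) (∑[ g ∈ gs ] (F g * b₁ g)) ⟩
      ϑ * ∑[ g ∈ gs ] (F g * b₀ g) + ψ * ∑[ g ∈ gs ] (F g * b₁ g)
        ∎

    total : ∑ indices w ≈ ϑ * ∑ gs b₀ + ψ * ∑ gs b₁
    total = begin-equality
      ∑ indices w
        ≈⟨ ∑-indices w ⟩
      ∑[ r ∈ allFin 2 ] ∑[ z ∈ allFin 2 ] ∑[ g ∈ gs ] w (r , z , g)
        ≈⟨ ∑-cong (allFin 2) (λ r → ∑-cong (allFin 2) (∑-slice-1 r)) ⟩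
      ∑[ r ∈ allFin 2 ] ∑[ z ∈ allFin 2 ] gated (∑ gs b₀) (∑ gs b₁) r z
        ≈⟨ ∑-gated (∑ gs b₀) (∑ gs b₁) ⟩
      ϑ * ∑ gs b₀ + ψ * ∑ gs b₁
        ∎

    sift₂ : ∀ (a : Fin 2) (f : Fin 2 → Carrier) → ∑[ x ∈ allFin 2 ] (𝟙 (a ≟ x) * f x) ≈ f a
    sift₂ a = ∑-sift _≟_ (Uniqueₚ.allFin⁺ 2) (∈-allFin a)

    -- The indicators of the two gate values sift the triple sum down to one slice. Its mass is
    -- `gated` applied to the masses of `b₀` and `b₁`, while the table is `gated` applied to the
    -- tables bounding them.
    occurrence-bound : ∀ k r z t →
      ∑[ i ∈ indices ] (𝟙 (Ê.marginal? (φ i) (occurrence k) (r , z , t)) * w i)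
        ≤ Ê.table (occurrence k) (r , z , t)
    occurrence-bound k a a′ t = begin
      ∑[ i ∈ indices ] (𝟙 (Ê.marginal? (φ i) (occurrence k) (a , a′ , t)) * w i)
        ≈⟨ ∑-cong indices (λ (r , z , g) → trans (*-congʳ (event r z g))
             (trans (*-assoc _ _ _) (*-congˡ (*-assoc _ _ _)))) ⟩
      ∑[ i ∈ indices ] f i
        ≈⟨ ∑-indices f ⟩
      ∑[ r ∈ allFin 2 ] ∑[ z ∈ allFin 2 ] ∑[ g ∈ gs ] f (r , z , g)
        ≈⟨ ∑-cong (allFin 2) (λ r → ∑-cong (allFin 2) λ z →
             trans (∑-*ˡ gs (𝟙 (a ≟ r)) (λ g → 𝟙 (a′ ≟ z) * (F g * w (r , z , g))))
                   (*-congˡ (∑-*ˡ gs (𝟙 (a′ ≟ z)) (λ g → F g * w (r , z , g))))) ⟩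
      ∑[ r ∈ allFin 2 ] ∑[ z ∈ allFin 2 ] (𝟙 (a ≟ r) * (𝟙 (a′ ≟ z) * slice r z))
        ≈⟨ ∑-cong (allFin 2) (λ r → trans
             (∑-*ˡ (allFin 2) (𝟙 (a ≟ r)) (λ z → 𝟙 (a′ ≟ z) * slice r z))
             (*-congˡ (sift₂ a′ (slice r)))) ⟩
      ∑[ r ∈ allFin 2 ] (𝟙 (a ≟ r) * slice r a′)
        ≈⟨ sift₂ a (λ r → slice r a′) ⟩
      slice a a′
        ≈⟨ ∑-slice F a a′ ⟩
      gated (E.mass b₀ (occurrence k) t) (E.mass b₁ (occurrence k) t) a a′
        ≤⟨ gated-mono (b₀-bound (occurrence k) t)
                      (E.mass≤table b₁-feasible (occurrence k) t) a a′ ⟩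
      gated (Ππ (symbol k) t) (μ (symbol k) t) a a′
        ≈⟨ occurrence-table k a a′ t ⟨
      Ê.table (occurrence k) (a , a′ , t)
        ∎
      where
      F : E.GlobalAssignment → Carrier
      F g = 𝟙 (E.marginal? (g E.at_) (occurrence k) t)

      f : Index → Carrier
      f (r , z , g) = 𝟙 (a ≟ r) * (𝟙 (a′ ≟ z) * (F g * w (r , z , g)))

      slice : Fin 2 → Fin 2 → Carrier
      slice r z = ∑[ g ∈ gs ] (F g * w (r , z , g))

      event : ∀ r z g → 𝟙 (Ê.marginal? (φ (r , z , g)) (occurrence k) (a , a′ , t)) ≈
                        𝟙 (a ≟ r) * (𝟙 (a′ ≟ z) * F g)
      event r z g = trans
        (𝟙-cong (Ê.marginal? (φ (r , z , g)) (occurrence k) (a , a′ , t))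
                (a ≟ r ×-dec (a′ ≟ z ×-dec t?))
                (λ { ≡.refl → ≡.refl , ≡.refl , ≡.refl })
                (λ { (≡.refl , ≡.refl , ≡.refl) → ≡.refl }))
        (trans (𝟙-× (a ≟ r) (a′ ≟ z ×-dec t?)) (*-congˡ (𝟙-× (a′ ≟ z) t?)))
        where t? = E.marginal? (g E.at_) (occurrence k) t

    -- Each value of a gate variable carries half of the mixed total. This is where the totals of
    -- `b₀` and `b₁` must be at most `1#`, since the gate links allow only `½`.
    gate-total≤½ : ½ * (ϑ * ∑ gs b₀ + ψ * ∑ gs b₁) ≤ ½
    gate-total≤½ = begin
      ½ * (ϑ * ∑ gs b₀ + ψ * ∑ gs b₁)
        ≤⟨ *-monoˡ-≤ 0≤½ (mixture-mono ∑b₀≤1 ∑b₁≤1) ⟩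
      ½ * (ϑ * 1# + ψ * 1#)
        ≈⟨ *-congˡ (ϑx+ψx≈x 1#) ⟩
      ½ * 1#
        ≈⟨ *-identityʳ ½ ⟩
      ½
        ∎

    first-gate : ∀ a → ∑[ i ∈ indices ] (𝟙 (proj₁ i ≟ a) * w i) ≤ ½
    first-gate a = begin
      ∑[ i ∈ indices ] (𝟙 (proj₁ i ≟ a) * w i)
        ≈⟨ ∑-indices _ ⟩
      ∑[ r ∈ allFin 2 ] ∑[ z ∈ allFin 2 ] ∑[ g ∈ gs ] (𝟙 (r ≟ a) * w (r , z , g))
        ≈⟨ ∑-cong (allFin 2) (λ r → trans
             (∑-cong (allFin 2) λ z → trans (∑-*ˡ gs (𝟙 (r ≟ a)) (λ g → w (r , z , g)))
               (*-cong (𝟙-cong (r ≟ a) (a ≟ r) ≡.sym ≡.sym) (∑-slice-1 r z)))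
             (∑-*ˡ (allFin 2) (𝟙 (a ≟ r)) (gated (∑ gs b₀) (∑ gs b₁) r))) ⟩
      ∑[ r ∈ allFin 2 ] (𝟙 (a ≟ r) * ∑[ z ∈ allFin 2 ] gated (∑ gs b₀) (∑ gs b₁) r z)
        ≈⟨ sift₂ a (λ r → ∑[ z ∈ allFin 2 ] gated (∑ gs b₀) (∑ gs b₁) r z) ⟩
      ∑[ z ∈ allFin 2 ] gated (∑ gs b₀) (∑ gs b₁) a z
        ≈⟨ ∑-gated-z (∑ gs b₀) (∑ gs b₁) a ⟩
      ½ * (ϑ * ∑ gs b₀ + ψ * ∑ gs b₁)
        ≤⟨ gate-total≤½ ⟩
      ½
        ∎

    second-gate : ∀ a → ∑[ i ∈ indices ] (𝟙 (proj₁ (proj₂ i) ≟ a) * w i) ≤ ½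
    second-gate a = begin
      ∑[ i ∈ indices ] (𝟙 (proj₁ (proj₂ i) ≟ a) * w i)
        ≈⟨ ∑-indices _ ⟩
      ∑[ r ∈ allFin 2 ] ∑[ z ∈ allFin 2 ] ∑[ g ∈ gs ] (𝟙 (z ≟ a) * w (r , z , g))
        ≈⟨ ∑-cong (allFin 2) (λ r → trans
             (∑-cong (allFin 2) λ z → trans (∑-*ˡ gs (𝟙 (z ≟ a)) (λ g → w (r , z , g)))
               (*-cong (𝟙-cong (z ≟ a) (a ≟ z) ≡.sym ≡.sym) (∑-slice-1 r z)))
             (sift₂ a (gated (∑ gs b₀) (∑ gs b₁) r))) ⟩
      ∑[ r ∈ allFin 2 ] gated (∑ gs b₀) (∑ gs b₁) r a
        ≈⟨ ∑-gated-r (∑ gs b₀) (∑ gs b₁) a ⟩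
      ½ * (ϑ * ∑ gs b₀ + ψ * ∑ gs b₁)
        ≤⟨ gate-total≤½ ⟩
      ½
        ∎

    link-bound : ∀ k j u → ∑[ i ∈ indices ] (𝟙 (Ê.marginal? (φ i) (link k j) u) * w i)
                             ≤ Ê.table (link k j) u
    link-bound k zero = Ê.link-bound indices w φ k zero
      (λ i x≢x → contradiction ≡.refl x≢x) first-gate
    link-bound k (suc zero) = Ê.link-bound indices w φ k (suc zero)
      (λ i x≢x → contradiction ≡.refl x≢x) second-gate
    -- An old link ignores `r` and `z`, so its mass is the mixture of the masses of `b₀` and `b₁`.
    -- Both layers have the same link table, and mixing it with itself gives it back.
    link-bound k (suc (suc j)) u = begin
      ∑[ i ∈ indices ] (𝟙 (Ê.marginal? (φ i) (link k (suc (suc j))) u) * w i)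
        ≈⟨ ∑-unconstrained (λ g → 𝟙 (E.marginal? (g E.at_) (link k j) u)) ⟩
      ϑ * E.mass b₀ (link k j) u + ψ * E.mass b₁ (link k j) u
        ≤⟨ mixture-mono (b₀-bound (link k j) u)
                        (E.mass≤table b₁-feasible (link k j) u) ⟩
      ϑ * E.table (link k j) u + ψ * E.table (link k j) u
        ≈⟨ ϑx+ψx≈x _ ⟩
      Ê.table (link k (suc (suc j))) u
        ∎

    open Ê.Pushforward indices w φ

    glued : Ê.GlobalAssignment → Carrier
    glued = pushforward

    glued-feasible : IsFeasible 𝔽 ê glued
    glued-feasible = pushforward-feasible w-nonNegative λ where
      (occurrence k) (r , z , t) → occurrence-bound k r z t
      (link k j)     u           → link-bound k j u

    glued-total : ∑ Ê.globalAssignments glued ≈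
                  ϑ * ∑ gs b₀ + ψ * ∑ gs b₁
    glued-total = trans total-pushforward total

  -- Upper bound: splitting a feasible gated weight.

  module Restricting {b : Ê.GlobalAssignment → Carrier} (b-feasible : IsFeasible 𝔽 ê b) where

    private
      gs : List Ê.GlobalAssignment
      gs = Ê.globalAssignments

      0≤b : ∀ g → 0# ≤ b g
      0≤b = IsFeasible.nonNegative b-feasible

    r z : Ê.GlobalAssignment → Fin 2
    r g = g Ê.at central zero zero
    z g = g Ê.at central zero (suc zero)

    φ : Ê.GlobalAssignment → (o : Observable 𝐗) → E.Outcome o
    φ g = forget (g Ê.at_)

    module _ (σ : Fin 2 → Fin 2) where

      -- `σ` is `id` for the half `r = z` and `opposite` for the half `r ≠ z`; the occurrence bound
      -- is proved once for both.
      w : Ê.GlobalAssignment → Carrier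
      w g = 𝟙 (z g ≟ σ (r g)) * b g

      w-nonNegative : ∀ g → 0# ≤ w g
      w-nonNegative g = *-nonNegative (𝟙-nonNegative (z g ≟ σ (r g))) (0≤b g)

      w-vanishes : ∀ g → b g ≈ 0# → w g ≈ 0#
      w-vanishes g b≈0 = trans (*-congˡ b≈0) (zeroʳ _)

      sliceTable : (k : Constraint) → Args (symbol k) → Carrier
      sliceTable k t = ∑[ a ∈ allFin 2 ] gated (Ππ (symbol k) t) (μ (symbol k) t) a (σ a)

      -- Where b does not vanish, the fresh copies of r and z agree with r and z.
      occurrence-bound : ∀ k t →
        ∑[ g ∈ gs ] (𝟙 (E.marginal? (φ g) (occurrence k) t) * w g) ≤ sliceTable k t
      occurrence-bound k t = begin
        ∑[ g ∈ gs ] (𝟙 (E.marginal? (φ g) (occurrence k) t) * w g)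
          ≤⟨ ∑-mono gs term ⟩
        ∑[ g ∈ gs ] ∑[ a ∈ allFin 2 ] f a g
          ≈⟨ ∑-swap gs (allFin 2) (λ g a → f a g) ⟩
        ∑[ a ∈ allFin 2 ] Ê.mass b (occurrence k) (a , σ a , t)
          ≤⟨ ∑-mono (allFin 2) (λ a → Ê.mass≤table b-feasible (occurrence k) (a , σ a , t)) ⟩
        ∑[ a ∈ allFin 2 ] Ê.table (occurrence k) (a , σ a , t)
          ≈⟨ ∑-cong (allFin 2) (λ a → occurrence-table k a (σ a) t) ⟩
        sliceTable k t
          ∎
        where
        event? : ∀ a g → Dec (Ê.restrict g (occurrence k) ≡ (a , σ a , t))
        event? a g = Ê.marginal? (g Ê.at_) (occurrence k) (a , σ a , t)

        f : Fin 2 → Ê.GlobalAssignment → Carrier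
        f a g = 𝟙 (event? a g) * b g

        f-nonNegative : ∀ g a → 0# ≤ f a g
        f-nonNegative g a = *-nonNegative (𝟙-nonNegative (event? a g)) (0≤b g)

        vanishing : ∀ g → b g ≈ 0# →
          𝟙 (E.marginal? (φ g) (occurrence k) t) * w g ≤ ∑[ a ∈ allFin 2 ] f a g
        vanishing g b≈0 =
          ≤-respˡ (sym (trans (*-congˡ (w-vanishes g b≈0)) (zeroʳ _)))
                  (∑-nonNegative (allFin 2) (f-nonNegative g))

        term : ∀ g → 𝟙 (E.marginal? (φ g) (occurrence k) t) * w g ≤ ∑[ a ∈ allFin 2 ] f a g
        term g with r g ≟ g Ê.at fresh k zero | z g ≟ g Ê.at fresh k (suc zero)
        ... | no r≢rᵏ  | _        = vanishing g (Ê.offDiagonal-vanishes b-feasible k zero g r≢rᵏ)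
        ... | yes _    | no z≢zᵏ  = vanishing g
                                      (Ê.offDiagonal-vanishes b-feasible k (suc zero) g z≢zᵏ)
        ... | yes r≡rᵏ | yes z≡zᵏ = begin
          𝟙 t? * (𝟙 (z g ≟ σ (r g)) * b g)   ≈⟨ *-assoc (𝟙 t?) _ (b g) ⟨
          𝟙 t? * 𝟙 (z g ≟ σ (r g)) * b g     ≈⟨ *-congʳ (𝟙-× t? (z g ≟ σ (r g))) ⟨
          𝟙 (t? ×-dec z g ≟ σ (r g)) * b g   ≤⟨ *-monoʳ-≤ (0≤b g) (𝟙-mono
                                                  (t? ×-dec z g ≟ σ (r g)) (event? (r g) g) hit) ⟩
          f (r g) g                          ≤⟨ ∑-∈ (f-nonNegative g) (∈-allFin (r g)) ⟩
          ∑[ a ∈ allFin 2 ] f a g            ∎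
          where
          t? = E.marginal? (φ g) (occurrence k) t
          hit : E.marginal (φ g) (occurrence k) ≡ t × z g ≡ σ (r g) →
                Ê.restrict g (occurrence k) ≡ (r g , σ (r g) , t)
          hit (≡.refl , z≡σr) =
            ≡.cong₂ _,_ (≡.sym r≡rᵏ) (≡.cong₂ _,_ (≡.trans (≡.sym z≡zᵏ) z≡σr) ≡.refl)

    -- One occurrence context suffices: its `r = z` entries sum over the gate value to `ϑ` times the
    -- product table, whose total is `1#`.
    same-total : Constraint →
      (∀ k → ∑ (allTuples (#dom ∘ sort (symbol k))) (Ππ (symbol k)) ≈ 1#) → ∑ gs (w id) ≤ ϑ
    same-total k Ππ-normalised = begin
      ∑ gs (w id)
        ≈⟨ ∑-cong gs (λ g → ∑-sift _≟ₜ_ (Listing.unique tuples)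
             (Listing.complete tuples (E.marginal (φ g) (occurrence k))) (λ _ → w id g)) ⟨
      ∑[ g ∈ gs ] ∑[ t ∈ ts ] (𝟙 (E.marginal? (φ g) (occurrence k) t) * w id g)
        ≈⟨ ∑-swap gs ts (λ g t → 𝟙 (E.marginal? (φ g) (occurrence k) t) * w id g) ⟩
      ∑[ t ∈ ts ] ∑[ g ∈ gs ] (𝟙 (E.marginal? (φ g) (occurrence k) t) * w id g)
        ≤⟨ ∑-mono ts (occurrence-bound id k) ⟩
      ∑[ t ∈ ts ] sliceTable id k t
        ≈⟨ ∑-cong ts (λ t → ∑-gated-same (Ππ (symbol k) t) (μ (symbol k) t)) ⟩
      ∑[ t ∈ ts ] (ϑ * Ππ (symbol k) t)
        ≈⟨ ∑-*ˡ ts ϑ (Ππ (symbol k)) ⟩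
      ϑ * ∑ ts (Ππ (symbol k))
        ≈⟨ *-congˡ (Ππ-normalised k) ⟩
      ϑ * 1#
        ≈⟨ *-identityʳ ϑ ⟩
      ϑ
        ∎
      where
      tuples : Listing (Args (symbol k))
      tuples = tupleListing (#dom ∘ sort (symbol k))
      ts : List (Args (symbol k))
      ts = Listing.elements tuples

    open E.Pushforward gs (λ g → ψ ⁻¹ * w opposite g) φ

    restricted : E.GlobalAssignment → Carrier
    restricted = pushforward

    rescaled-occurrence-bound : ∀ k t →
      ∑[ g ∈ gs ] (𝟙 (E.marginal? (φ g) (occurrence k) t) * (ψ ⁻¹ * w opposite g)) ≤ μ (symbol k) t
    rescaled-occurrence-bound k t = begin
      ∑[ g ∈ gs ] (𝟙 (E.marginal? (φ g) (occurrence k) t) * (ψ ⁻¹ * w opposite g))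
        ≈⟨ ∑-cong gs (λ g → Solver.solve 3 (λ i p x →
             let open Solver in i :* (p :* x) := p :* (i :* x))
             refl (𝟙 (E.marginal? (φ g) (occurrence k) t)) (ψ ⁻¹) (w opposite g)) ⟩
      ∑[ g ∈ gs ] (ψ ⁻¹ * (𝟙 (E.marginal? (φ g) (occurrence k) t) * w opposite g))
        ≈⟨ ∑-*ˡ gs (ψ ⁻¹) (λ g → 𝟙 (E.marginal? (φ g) (occurrence k) t) * w opposite g) ⟩
      ψ ⁻¹ * ∑[ g ∈ gs ] (𝟙 (E.marginal? (φ g) (occurrence k) t) * w opposite g)
        ≤⟨ *-monoˡ-≤ (⁻¹-nonNegative 0<ψ) (occurrence-bound opposite k t) ⟩
      ψ ⁻¹ * sliceTable opposite k t
        ≈⟨ *-congˡ (∑-gated-opposite (Ππ (symbol k) t) (μ (symbol k) t)) ⟩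
      ψ ⁻¹ * (ψ * μ (symbol k) t)
        ≈⟨ *-assoc (ψ ⁻¹) ψ _ ⟨
      ψ ⁻¹ * ψ * μ (symbol k) t
        ≈⟨ *-congʳ (*-inverseˡ 0<ψ) ⟩
      1# * μ (symbol k) t
        ≈⟨ *-identityˡ _ ⟩
      μ (symbol k) t
        ∎

    restricted-feasible : IsBalanced 𝔽 𝒯 → IsFeasible 𝔽 e restricted
    restricted-feasible balanced = pushforward-feasible
      (λ g → *-nonNegative (⁻¹-nonNegative 0<ψ) (w-nonNegative opposite g)) λ where
      (occurrence k) t → rescaled-occurrence-bound k t
      -- The gated links contribute only the diagonal support here. The size of the bound comes from
      -- the rescaled occurrence bounds and the marginals of `μ`.
      (link k j)     u → E.occurrence-bound⇒link-bound gs (λ g → ψ ⁻¹ * w opposite g) φ k j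
        (λ g x≢y → trans (*-congˡ (w-vanishes opposite g
           (Ê.offDiagonal-vanishes b-feasible k (suc (suc j)) g x≢y))) (zeroʳ _))
        (λ a → ≤-reflexive (trans
           (sym (∑-filter (λ t → lookup t j ≟ a)
                          (allTuples (#dom ∘ sort (symbol k))) (μ (symbol k))))
           (IsBalanced.μ-marginal balanced (symbol k) j a)))
        (rescaled-occurrence-bound k) u

    restricted-total : ψ * ∑ E.globalAssignments restricted ≈ ∑ gs (w opposite)
    restricted-total = begin-equality
      ψ * ∑ E.globalAssignments restricted          ≈⟨ *-congˡ total-pushforward ⟩
      ψ * ∑[ g ∈ gs ] (ψ ⁻¹ * w opposite g)         ≈⟨ *-congˡ (∑-*ˡ gs (ψ ⁻¹) (w opposite)) ⟩
      ψ * (ψ ⁻¹ * ∑ gs (w opposite))                ≈⟨ *-assoc ψ (ψ ⁻¹) _ ⟨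
      ψ * ψ ⁻¹ * ∑ gs (w opposite)                  ≈⟨ *-congʳ (⁻¹-inverse ψ (<⇒≉ˡ 0<ψ)) ⟩
      1# * ∑ gs (w opposite)                        ≈⟨ *-identityˡ _ ⟩
      ∑ gs (w opposite)                             ∎

    total-splits : ∑ gs b ≈ ∑ gs (w id) + ψ * ∑ E.globalAssignments restricted
    total-splits = begin-equality
      ∑ gs b
        ≈⟨ ∑-cong gs (λ g → begin-equality
             b g                                               ≈⟨ *-identityˡ (b g) ⟨
             1# * b g                                          ≈⟨ *-congʳ (same-or-opposite (r g) (z g)) ⟨
             (𝟙 (z g ≟ r g) + 𝟙 (z g ≟ opposite (r g))) * b g  ≈⟨ distribʳ (b g) _ _ ⟩
             w id g + w opposite g                             ∎) ⟩
      ∑[ g ∈ gs ] (w id g + w opposite g)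
        ≈⟨ ∑-+ gs (w id) (w opposite) ⟩
      ∑ gs (w id) + ∑ gs (w opposite)
        ≈⟨ +-congˡ restricted-total ⟨
      ∑ gs (w id) + ψ * ∑ E.globalAssignments restricted
        ∎

  -- Supported assignments of the gated lift.

  module Supported (balanced : IsBalanced 𝔽 𝒯) where

    -- A domain cannot be empty, because the empty sum is `0#` while `π s` sums to `1#`.
    default : ∀ s → Dom s
    default s = pick _ (π s) (IsDistribution.normalised (IsBalanced.π-distribution balanced s))
      where
      pick : ∀ n (p : Fin n → Carrier) → ∑ (allFin n) p ≈ 1# → Fin n
      pick zero    p 0≈1 = contradiction 0≈1 0≉1
      pick (suc n) p _   = zero

    homomorphism : Homomorphism X̂ (gateStructure 𝐁)
    homomorphism = record
      { assign    = λ { zero _ → zero ; (suc s) _ → default s }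
      -- Equal gate values satisfy every gated constraint through its `gateRelation₀` part, whatever
      -- the old variables do.
      ; satisfies = λ _ → inj₁ ≡.refl
      }

    valuation : (o : Observable X̂) → Ê.Outcome o
    valuation = extend zero zero λ where
      (central s x) → default s
      (fresh k j)   → default (sortAt k j)

    gateπ-positive : ∀ s a → 0# < gateπ 𝔽 𝒯 s a
    gateπ-positive zero    a = 0<½
    gateπ-positive (suc s) a = IsBalanced.π-fullSupport balanced s a

    link-positive : ∀ k j a → 0# < Ê.table (link k j) (a , a , tt)
    link-positive k j a = <-≤-trans (gateπ-positive (Instance.sortAt X̂ k j) a)
      (≤-reflexive (sym (begin-equality
      Ê.table (link k j) (a , a , tt)                      ≈⟨ Ê.link-table k j a a ⟩
      𝟙 (a ≟ a) * gateπ 𝔽 𝒯 (Instance.sortAt X̂ k j) a      ≈⟨ *-congʳ (𝟙-yes (a ≟ a) ≡.refl) ⟩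
      1# * gateπ 𝔽 𝒯 (Instance.sortAt X̂ k j) a             ≈⟨ *-identityˡ _ ⟩
      gateπ 𝔽 𝒯 (Instance.sortAt X̂ k j) a                  ∎)))

    -- At `r = z` the `ν₀` summand of an occurrence entry is already positive, as a product of `ϑ`,
    -- `½` and values of `π`; the `ν₁` summand has a zero indicator there.
    valuation-positive : ∀ C → 0# < Ê.table C (Ê.marginal valuation C)
    valuation-positive (occurrence k) = <-≤-trans
      (*-positive 0<ϑ (*-positive 0<1 (*-positive 0<½ (productOver-positive (allFin _) λ j →
        IsBalanced.π-fullSupport balanced (sortAt k j) (lookup t j)))))
      (≤-respʳ (sym (occurrence-table k zero zero t))
        (x≤x+y _ (*-nonNegative 0≤ψ (*-nonNegative ≤-refl (*-nonNegative 0≤½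
          (IsDistribution.nonNegative (IsBalanced.μ-distribution balanced (symbol k)) t))))))
      where
      t : Args (symbol k)
      t = fromFunction (λ j → default (sortAt k j))
    valuation-positive (link k zero)          = link-positive k zero zero
    valuation-positive (link k (suc zero))    = link-positive k (suc zero) zero
    valuation-positive (link k (suc (suc j))) = link-positive k (suc (suc j)) (default (sortAt k j))

    supported : ∃[ g ] IsSupported 𝔽 ê g
    supported = Ê.assignment valuation , λ C →
      ≡.subst (λ u → 0# < Ê.table C u) (≡.sym (Ê.restrict-assignment valuation C))
              (valuation-positive C)

  -- The value of the gated noncontextual fraction.

  module NoncontextualFraction (balanced : IsBalanced 𝔽 𝒯) (simple : IsSimple 𝐗)
                               (k : Constraint) where

    private
      module P = ProductLift 𝔽 𝐗 simple 𝒯 balanced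

    -- The occurrence table of the constraint `k` sums to `1#`. Without any constraint there would
    -- be no table to cap the total.
    total≤1 : ∀ b → IsFeasible 𝔽 e b → ∑ E.globalAssignments b ≤ 1#
    total≤1 b feas = ≤-respʳ
      (IsDistribution.normalised (IsBalanced.μ-distribution balanced (symbol k)))
      (E.total≤∑table feas (occurrence k))

    product-total : ∑ E.globalAssignments P.product ≈ 1#
    product-total = ≡.subst (λ gs → ∑ gs P.product ≈ 1#)
      (globalAssignments-independent 𝔽 𝐗 (productTables 𝔽 𝒯) 𝒯) P.product-total

    ncf : ∃ (IsNCF 𝔽 e)
    ncf = E.ncf-exists (E.tables-nonNegative balanced) 1# total≤1

    module _ {p : Carrier} (p-ncf : IsNCF 𝔽 e p) where

      p-nonNegative : 0# ≤ p
      p-nonNegative with proj₁ p-ncf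
      ... | b , feas , ∑b≈p =
        ≤-respʳ ∑b≈p (∑-nonNegative E.globalAssignments (IsFeasible.nonNegative feas))

      gated-ncf : IsNCF 𝔽 ê (ϑ + ψ * p)
      gated-ncf with proj₁ p-ncf
      ... | b₁ , b₁-feasible , ∑b₁≈p = (G.glued , G.glued-feasible , attained) , bound
        where
        module G = Gluing P.product-feasible b₁-feasible (≤-reflexive product-total)
                          (total≤1 b₁ b₁-feasible)

        attained : ∑ Ê.globalAssignments G.glued ≈ ϑ + ψ * p
        attained = trans G.glued-total
          (+-cong (trans (*-congˡ product-total) (*-identityʳ ϑ)) (*-congˡ ∑b₁≈p))

        bound : ∀ w → ∃[ b ] IsFeasible 𝔽 ê b × ∑ Ê.globalAssignments b ≈ w → w ≤ ϑ + ψ * p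
        bound w (b , feas , ∑b≈w) = begin
          w
            ≈⟨ ∑b≈w ⟨
          ∑ Ê.globalAssignments b
            ≈⟨ R.total-splits ⟩
          ∑ Ê.globalAssignments (R.w id) + ψ * ∑ E.globalAssignments R.restricted
            -- The `r = z` half is capped by `ϑ`; the rescaled `r ≠ z` half is feasible for `e` and
            -- so competes in the maximum `p`.
            ≤⟨ +-mono-≤ (R.same-total k P.productTable-normalised)
                 (*-monoˡ-≤ 0≤ψ (proj₂ p-ncf _
                   (R.restricted , R.restricted-feasible balanced , refl))) ⟩
          ϑ + ψ * p
            ∎
          where module R = Restricting feas

theorem6p1 : ∀ {c ℓ₁ ℓ₂} (𝔽 : OrderedField c ℓ₁ ℓ₂) → let open OrderedField 𝔽 in
    (𝓢 : Signature) (𝐁 : Structure 𝓢) (𝒯 : Tables 𝔽 𝐁) → IsBalanced 𝔽 𝒯 →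
    (ϑ : Carrier) → 0# < ϑ → ϑ < 1# →
    ((𝐗 : Instance 𝓢) → IsSimple 𝐗 → IsNonempty 𝐗 →
    ∃[ p ] ∃[ q ]
    IsNCF 𝔽 (occurrenceLift 𝔽 𝐗 𝒯) p ×
    IsNCF 𝔽 (occurrenceLift 𝔽 (gateInstance 𝐗) (gateTables 𝔽 𝒯 ϑ)) q ×
    q ≈ ϑ + (1# - ϑ) * p ×
    ϑ ≤ q)
    × ((𝐗 : Instance 𝓢) →
    Homomorphism (gateInstance 𝐗) (gateStructure 𝐁) ×
    (∃[ g ] IsSupported 𝔽 (occurrenceLift 𝔽 (gateInstance 𝐗) (gateTables 𝔽 𝒯 ϑ)) g))
theorem6p1 𝔽 𝓢 𝐁 𝒯 balanced ϑ 0<ϑ ϑ<1 =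
  (λ 𝐗 simple nonempty →
    let open GatedLift 𝔽 𝐗 𝒯 ϑ 0<ϑ ϑ<1
        open NoncontextualFraction balanced simple (fromℕ< nonempty)
        p , p-ncf = ncf
    in p , (ϑ + ψ * p) , p-ncf , gated-ncf p-ncf , refl ,
       x≤x+y ϑ (*-nonNegative 0≤ψ (p-nonNegative p-ncf))) ,
  (λ 𝐗 →
    let open GatedLift 𝔽 𝐗 𝒯 ϑ 0<ϑ ϑ<1
        open Supported balanced
    in homomorphism , supported)
  where
  open OrderedField 𝔽
  open OrderedFieldProperties 𝔽
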